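{- Let $d:\{0,1,2\}^*\to[0,1]$ satisfy $d(\lambda)=1$ and $d(\sigma)=\sum_{i=0}^{2}d(\sigma^\frown i)$ for all $\sigma\in\{0,1,2\}^*$, and let $\mu_d^*$ be the associated probability measure on the space $\mathcal{C}$ of nonempty closed subsets of $2^{\mathbb{N}}$. Then the function $\mathcal{T}_d$, defined for closed $Q\subseteq 2^{\mathbb{N}}$ by $\mathcal{T}_d(Q)=\mu_d^*(\{K\in\mathcal{C}: K\cap Q\neq\emptyset\})$, is a capacity. Moreover, if $\mu_d^*$ is a computable measure, then $\mathcal{T}_d$ is a computable capacity.
   Context: For $\sigma\in\{0,1\}^*$, $I(\sigma)=\{x\in 2^{\mathbb{N}}:\sigma\sqsubset x\}$; similarly for $\sigma\in\{0,1,2\}^*$, $I(\sigma)\subseteq\{0,1,2\}^{\mathbb{N}}$. $\lambda$ is the empty string and $^\frown$ is concatenation. Codes of closed sets: for a nonempty closed $Q\subseteq 2^{\mathbb{N}}$ let $T_Q=\{\sigma\in\{0,1\}^*: Q\cap I(\sigma)\ne\emptyset\}$, and let $\sigma_0,\sigma_1,\dots$ enumerate $T_Q$ first by length and then lexicographically. The code $x_Q\in\{0,1,2\}^{\mathbb{N}}$ is given by: $x_Q(n)=2$ if both $\sigma_n{}^\frown 0,\sigma_n{}^\frown 1\in T_Q$; $x_Q(n)=1$ if only $\sigma_n{}^\frown 1\in T_Q$; $x_Q(n)=0$ if only $\sigma_n{}^\frown 0\in T_Q$. The map $Q\mapsto x_Q$ is a homeomorphism from $\mathcal{C}$ (with the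 hit-or-miss topology, generated by the sets $\{K: K\cap U\ne\emptyset\}$ and $\{K: K\subseteq U\}$ for $U$ open) onto $\{0,1,2\}^{\mathbb{N}}$. Measures: $\mu_d$ is the Borel probability measure on $\{0,1,2\}^{\mathbb{N}}$ with $\mu_d(I(\sigma))=d(\sigma)$, and $\mu_d^*(\mathcal{X})=\mu_d(\{x_Q:Q\in\mathcal{X}\})$ for Borel $\mathcal{X}\subseteq\mathcal{C}$. For a tree $A\subseteq\{0,1\}^{\le n}$ let $U_A=\{K\in\mathcal{C}: T_K\cap\{0,1\}^{\le n}=A\}$; the clopen subsets of $\mathcal{C}$ are the finite unions of sets $U_A$. A measure $\mu^*$ on $\mathcal{C}$ is computable if its restriction to the clopen subsets of $\mathcal{C}$ (given as finite unions of sets $U_A$) is a computable real-valued function. Capacity: a capacity is a function $\mathcal{T}$ from the closed subsets of $2^{\mathbb{N}}$ (including $\emptyset$) to $[0,1]$ with $\mathcal{T}(\emptyset)=0$ and $\mathcal{T}(2^{\mathbb{N}})=1$ such that (1) $Q_1\subseteq Q_2$ implies $\mathcal{T}(Q_1)\le\mathcal{T}(Q_2)$; (2) for $n\ge 2$ and closed $Q_1,\dots,Q_n$, $\mathcal{T}(\bigcap_{i=1}^nQ_i)\le\sum\{(-1)^{|I|+1}\mathcal{T}(\bigcup_{i\in I}Q_i):\emptyset\ne I\subseteq\{1,\dots,n\}\}$; (3) if $Q=\bigcap_nQ_n$ with $Q_{n+1}\subseteq Q_n$ closed for all $n$, then $\mathcal{T}(Q)=\lim_{n}\mathcal{T}(Q_n)$.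 A capacity is computable if its restriction to the Boolean algebra of clopen subsets of $2^{\mathbb{N}}$ (finite unions of intervals $I(\sigma)$) is a computable real-valued function. -}

module Defs where

open import Algebra.Bundles using (module CommutativeMonoid)
import Algebra.Properties.CommutativeSemigroup as CommutativeSemigroup
open import Data.Bool.Base as Bool using (Bool; true; false; if_then_else_)
open import Data.Fin.Base using (Fin; zero; suc)
open import Data.Fin.Subset as Subset using (Subset; inside; outside; Nonempty)
open import Data.Fin.Subset.Properties using (nonempty?)
open import Data.Integer.Base using (_⊖_)
open import Data.List.Base as List
  using (List; []; _∷_; _++_; _∷ʳ_; length; applyUpTo; foldr; filter)
open import Data.List.Membership.Propositional as List∈ using ()
open import Data.List.Relation.Binary.Lex.Strict using (Lex-<)
open import Data.List.Relation.Unary.All using (All)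
open import Data.List.Relation.Unary.Any using (Any)
open import Data.Nat.Base as ℕ using (ℕ; zero; suc)
import Data.Nat.Properties as ℕₚ
open import Data.Product.Base using (Σ-syntax; ∃; ∃-syntax; _×_; _,_; proj₁; proj₂)
open import Data.Rational.Base as ℚ using (ℚ; 0ℚ; 1ℚ; ½)
import Data.Rational.Properties as ℚₚ
open import Data.Sum.Base using (_⊎_)
open import Data.Vec.Base as Vec using ()
open import Function.Base using (_∘_)
open import Level using (Level; Lift; 0ℓ) renaming (suc to lsuc)
open import Relation.Binary.PropositionalEquality
  using (_≡_; _≢_; refl; sym; trans; cong; subst)
open import Relation.Unary using
  (Pred; _∈_; _∉_; _⊆_; _≐_; _≬_; _⊥_; _∩_; ∁; ∅; U; Satisfiable; ⋃; ⋂)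

1ℓ : Level
1ℓ = lsuc 0ℓ

------------------------------------------------------------------------
-- Real numbers: Cauchy sequences of rationals.  Equality is the usual
-- one (the difference tends to 0), expressed by antisymmetry of _≤_.
-- Only the additive and order structure is needed.

IsCauchy : (ℕ → ℚ) → Set
IsCauchy s = ∀ ε → 0ℚ ℚ.< ε →
  ∃[ N ] (∀ m n → N ℕ.≤ m → N ℕ.≤ n → ℚ.∣ s m ℚ.- s n ∣ ℚ.≤ ε)

record ℝ : Set where
  constructor mkℝ
  field
    seq    : ℕ → ℚ
    cauchy : IsCauchy seq

open ℝ public

private
  half>0 : ∀ ε → 0ℚ ℚ.< ε → 0ℚ ℚ.< ½ ℚ.* ε
  half>0 ε ε>0 = subst (ℚ._< ½ ℚ.* ε) (ℚₚ.*-zeroʳ ½) (ℚₚ.*-monoʳ-<-pos ½ ε>0)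

  half+half : ∀ ε → ½ ℚ.* ε ℚ.+ ½ ℚ.* ε ≡ ε
  half+half ε = trans (sym (ℚₚ.*-distribʳ-+ ε ½ ½)) (ℚₚ.*-identityˡ ε)

  interchange : ∀ a b c d →
    (a ℚ.+ b) ℚ.- (c ℚ.+ d) ≡ (a ℚ.- c) ℚ.+ (b ℚ.- d)
  interchange a b c d = trans (cong (a ℚ.+ b ℚ.+_) (ℚₚ.neg-distrib-+ c d))
    (CommutativeSemigroup.interchange (CommutativeMonoid.commutativeSemigroup ℚₚ.+-0-commutativeMonoid) a b (ℚ.- c) (ℚ.- d))

  neg-interchange : ∀ a b → (ℚ.- a) ℚ.- (ℚ.- b) ≡ ℚ.- (a ℚ.- b)
  neg-interchange a b = sym (ℚₚ.neg-distrib-+ a (ℚ.- b))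

fromℚ : ℚ → ℝ
fromℚ q = mkℝ (λ _ → q) λ ε ε>0 → 0 , λ _ _ _ _ →
  subst (λ z → ℚ.∣ z ∣ ℚ.≤ ε) (sym (ℚₚ.+-inverseʳ q)) (ℚₚ.<⇒≤ ε>0)

infixl 6 _+_
infix  8 -_
infix  4 _≤_ _≃_

_+_ : ℝ → ℝ → ℝ
mkℝ s cs + mkℝ t ct = mkℝ (λ n → s n ℚ.+ t n) λ ε ε>0 →
  let (M , hs) = cs (½ ℚ.* ε) (half>0 ε ε>0)
      (N , ht) = ct (½ ℚ.* ε) (half>0 ε ε>0)
  in M ℕ.⊔ N , λ m n m≥ n≥ → let open ℚₚ.≤-Reasoning in begin
    ℚ.∣ (s m ℚ.+ t m) ℚ.- (s n ℚ.+ t n) ∣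
      ≡⟨ cong ℚ.∣_∣ (interchange (s m) (t m) (s n) (t n)) ⟩
    ℚ.∣ (s m ℚ.- s n) ℚ.+ (t m ℚ.- t n) ∣
      ≤⟨ ℚₚ.∣p+q∣≤∣p∣+∣q∣ (s m ℚ.- s n) (t m ℚ.- t n) ⟩
    ℚ.∣ s m ℚ.- s n ∣ ℚ.+ ℚ.∣ t m ℚ.- t n ∣
      ≤⟨ ℚₚ.+-mono-≤
           (hs m n (ℕₚ.m⊔n≤o⇒m≤o M N m≥) (ℕₚ.m⊔n≤o⇒m≤o M N n≥))
           (ht m n (ℕₚ.m⊔n≤o⇒n≤o M N m≥) (ℕₚ.m⊔n≤o⇒n≤o M N n≥)) ⟩
    ½ ℚ.* ε ℚ.+ ½ ℚ.* ε
      ≡⟨ half+half ε ⟩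
    ε ∎

-_ : ℝ → ℝ
- mkℝ s cs = mkℝ (λ n → ℚ.- s n) λ ε ε>0 →
  let (N , hs) = cs ε ε>0 in N , λ m n m≥ n≥ →
    subst (ℚ._≤ ε)
      (sym (trans (cong ℚ.∣_∣ (neg-interchange (s m) (s n)))
                  (ℚₚ.∣-p∣≡∣p∣ (s m ℚ.- s n))))
      (hs m n m≥ n≥)

0ℝ 1ℝ : ℝ
0ℝ = fromℚ 0ℚ
1ℝ = fromℚ 1ℚ

_≤_ : ℝ → ℝ → Set
x ≤ y = ∀ ε → 0ℚ ℚ.< ε → ∃[ N ] (∀ n → N ℕ.≤ n → seq x n ℚ.≤ seq y n ℚ.+ ε)

_≃_ : ℝ → ℝ → Set
x ≃ y = x ≤ y × y ≤ x

∣_-_∣≤_ : ℝ → ℝ → ℚ → Set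
∣ x - y ∣≤ ε = x ≤ y + fromℚ ε × y ≤ x + fromℚ ε

ConvergesTo : (ℕ → ℝ) → ℝ → Set
ConvergesTo a x = ∀ ε → 0ℚ ℚ.< ε → ∃[ N ] (∀ n → N ℕ.≤ n → ∣ a n - x ∣≤ ε)

sum : List ℝ → ℝ
sum = foldr _+_ 0ℝ

-1^_·_ : ℕ → ℝ → ℝ
-1^ zero  · x = x
-1^ suc k · x = - (-1^ k · x)

------------------------------------------------------------------------
-- Sequence spaces with the product topology

2^ℕ 3^ℕ : Set
2^ℕ = ℕ → Bool
3^ℕ = ℕ → Fin 3

I : {A : Set} → List A → Pred (ℕ → A) 0ℓ
I σ x = applyUpTo x (length σ) ≡ σ

IsOpen : ∀ {ℓ} {A : Set} → Pred (ℕ → A) ℓ → Set ℓ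
IsOpen G = ∀ x → x ∈ G → ∃[ n ] (I (applyUpTo x n) ⊆ G)

IsClosed : ∀ {ℓ} {A : Set} → Pred (ℕ → A) ℓ → Set ℓ
IsClosed Q = IsOpen (∁ Q)

------------------------------------------------------------------------
-- Borel probability measures.  Subsets of 3^ℕ are taken one universe up
-- because images of families of closed subsets of 2^ℕ live there.

data IsBorel {A : Set} : Pred (ℕ → A) 1ℓ → Set (lsuc 1ℓ) where
  open-set   : ∀ {G} → IsOpen G → IsBorel G
  complement : ∀ {B} → IsBorel B → IsBorel (∁ B)
  union      : ∀ {B : ℕ → Pred (ℕ → A) 1ℓ} →
               (∀ n → IsBorel (B n)) → IsBorel (⋃ ℕ B)
  respects-≐ : ∀ {B C} → B ≐ C → IsBorel B → IsBorel C

↑ : {A : Set} → Pred A 0ℓ → Pred A 1ℓ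
↑ B x = Lift 1ℓ (x ∈ B)

-- A measure is represented by a function on all subsets, about which
-- nothing is assumed outside the Borel sets.

record IsBorelProbability {A : Set} (μ : Pred (ℕ → A) 1ℓ → ℝ) : Set (lsuc 1ℓ) where
  field
    cong-≐   : ∀ {B C} → IsBorel B → IsBorel C → B ≐ C → μ B ≃ μ C
    nonneg   : ∀ {B} → IsBorel B → 0ℝ ≤ μ B
    empty    : μ (↑ ∅) ≃ 0ℝ
    total    : μ (↑ U) ≃ 1ℝ
    additive : (B : ℕ → Pred (ℕ → A) 1ℓ) → (∀ n → IsBorel (B n)) →
               (∀ m n → m ≢ n → B m ⊥ B n) →
               ConvergesTo (λ n → sum (applyUpTo (μ ∘ B) n)) (μ (⋃ ℕ B))

record IsMassFunction (d : List (Fin 3) → ℝ) : Set where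
  field
    lower : ∀ σ → 0ℝ ≤ d σ
    upper : ∀ σ → d σ ≤ 1ℝ
    root  : d [] ≃ 1ℝ
    split : ∀ σ → d σ ≃
      d (σ ∷ʳ zero) + d (σ ∷ʳ suc zero) + d (σ ∷ʳ suc (suc zero))

------------------------------------------------------------------------
-- Nonempty closed subsets of 2^ℕ and their codes

record 𝒞 : Set₁ where
  field
    carrier  : Pred 2^ℕ 0ℓ
    closed   : IsClosed carrier
    nonempty : Satisfiable carrier

open 𝒞 public

T[_] : 𝒞 → Pred (List Bool) 0ℓ
T[ K ] σ = carrier K ≬ I σ

-- Length first, then lexicographically.

_≺_ : List Bool → List Bool → Set
σ ≺ τ = length σ ℕ.< length τ
      ⊎ (length σ ≡ length τ × Lex-< _≡_ Bool._<_ σ τ)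

record Enumerates (s : ℕ → List Bool) (T : Pred (List Bool) 0ℓ) : Set where
  field
    sound      : ∀ n → s n ∈ T
    complete   : ∀ σ → σ ∈ T → ∃[ n ] s n ≡ σ
    increasing : ∀ m n → m ℕ.< n → s m ≺ s n

data Symbol (T : Pred (List Bool) 0ℓ) (σ : List Bool) : Fin 3 → Set where
  only-0 : (σ ∷ʳ false) ∈ T → (σ ∷ʳ true) ∉ T → Symbol T σ zero
  only-1 : (σ ∷ʳ false) ∉ T → (σ ∷ʳ true) ∈ T → Symbol T σ (suc zero)
  both   : (σ ∷ʳ false) ∈ T → (σ ∷ʳ true) ∈ T → Symbol T σ (suc (suc zero))

-- IsCode K x says that x is x_K.

IsCode : 𝒞 → 3^ℕ → Set
IsCode K x = Σ[ s ∈ (ℕ → List Bool) ]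
  Enumerates s T[ K ] × (∀ n → Symbol T[ K ] (s n) (x n))

codes : Pred 𝒞 0ℓ → Pred 3^ℕ 1ℓ
codes 𝒳 x = Σ[ K ∈ 𝒞 ] K ∈ 𝒳 × IsCode K x

infixl 9 _*

_* : (Pred 3^ℕ 1ℓ → ℝ) → Pred 𝒞 0ℓ → ℝ
(μ *) 𝒳 = μ (codes 𝒳)

𝒯 : (Pred 3^ℕ 1ℓ → ℝ) → Pred 2^ℕ 0ℓ → ℝ
𝒯 μ Q = (μ *) (λ K → carrier K ≬ Q)

------------------------------------------------------------------------
-- Capacities, represented by functions on all subsets of 2^ℕ about
-- which nothing is required outside the closed sets.

subsets : ∀ n → List (Subset n)
subsets zero    = Vec.[] ∷ []
subsets (suc n) = List.map (outside Vec.∷_) (subsets n)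
               ++ List.map (inside  Vec.∷_) (subsets n)

nonemptySubsets : ∀ n → List (Subset n)
nonemptySubsets n = filter nonempty? (subsets n)

⋃⟨_⟩ : ∀ {n} → Subset n → (Fin n → Pred 2^ℕ 0ℓ) → Pred 2^ℕ 0ℓ
⋃⟨ J ⟩ Q x = ∃[ i ] i Subset.∈ J × x ∈ Q i

record IsCapacity (T : Pred 2^ℕ 0ℓ → ℝ) : Set₁ where
  field
    lower       : ∀ Q → IsClosed Q → 0ℝ ≤ T Q
    upper       : ∀ Q → IsClosed Q → T Q ≤ 1ℝ
    empty       : T ∅ ≃ 0ℝ
    full        : T U ≃ 1ℝ
    monotone    : ∀ Q R → IsClosed Q → IsClosed R → Q ⊆ R → T Q ≤ T R
    alternating : ∀ n → 2 ℕ.≤ n → (Q : Fin n → Pred 2^ℕ 0ℓ) →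
      (∀ i → IsClosed (Q i)) →
      T (⋂ (Fin n) Q) ≤
        sum (List.map (λ J → -1^ suc Subset.∣ J ∣ · T (⋃⟨ J ⟩ Q)) (nonemptySubsets n))
    continuous  : (Q : Pred 2^ℕ 0ℓ) (R : ℕ → Pred 2^ℕ 0ℓ) →
      (∀ n → IsClosed (R n)) → (∀ n → R (suc n) ⊆ R n) → Q ≐ ⋂ ℕ R →
      ConvergesTo (T ∘ R) (T Q)

------------------------------------------------------------------------
-- Computable functions on hereditarily finite data: Kleene's general
-- recursive functions, i.e. the least class containing the basic
-- functions and closed under composition, primitive recursion and
-- minimisation of functions that always have a zero, with pairs,
-- booleans and lists as primitive data instead of Gödel numbers.

data Ty : Set where
  bool nat : Ty
  list     : Ty → Ty
  _⊗_      : Ty → Ty → Ty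

infixr 5 _⊗_

⟦_⟧ : Ty → Set
⟦ bool ⟧   = Bool
⟦ nat ⟧    = ℕ
⟦ list A ⟧ = List ⟦ A ⟧
⟦ A ⊗ B ⟧  = ⟦ A ⟧ × ⟦ B ⟧

recℕ : {A B : Set} → (A → B) → (A × ℕ × B → B) → A × ℕ → B
recℕ z s (a , zero)  = z a
recℕ z s (a , suc n) = s (a , n , recℕ z s (a , n))

recList : {A B C : Set} → (A → B) → (A × C × List C × B → B) → A × List C → B
recList z s (a , [])     = z a
recList z s (a , c ∷ cs) = s (a , c , cs , recList z s (a , cs))

data Computable : (A B : Ty) → (⟦ A ⟧ → ⟦ B ⟧) → Set where
  ext     : ∀ {A B f g} → (∀ a → f a ≡ g a) →
            Computable A B f → Computable A B g
  id      : ∀ {A} → Computable A A (λ a → a)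
  comp    : ∀ {A B C f g} → Computable B C g → Computable A B f →
            Computable A C (λ a → g (f a))
  pair    : ∀ {A B C f g} → Computable A B f → Computable A C g →
            Computable A (B ⊗ C) (λ a → f a , g a)
  fst     : ∀ {A B} → Computable (A ⊗ B) A proj₁
  snd     : ∀ {A B} → Computable (A ⊗ B) B proj₂
  boolean : ∀ {A} b → Computable A bool (λ _ → b)
  cond    : ∀ {A} → Computable (bool ⊗ A ⊗ A) A
              (λ (b , x , y) → if b then x else y)
  zero    : ∀ {A} → Computable A nat (λ _ → 0)
  suc     : Computable nat nat suc
  natrec  : ∀ {A B z s} → Computable A B z → Computable (A ⊗ nat ⊗ B) B s →
            Computable (A ⊗ nat) B (recℕ z s)
  nil     : ∀ {A B} → Computable A (list B) (λ _ → [])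
  cons    : ∀ {A} → Computable (A ⊗ list A) (list A) (λ (x , xs) → x ∷ xs)
  listrec : ∀ {A B C z s} → Computable A B z →
            Computable (A ⊗ C ⊗ list C ⊗ B) B s →
            Computable (A ⊗ list C) B (recList z s)
  min     : ∀ {A f} (g : ⟦ A ⟧ → ℕ) → Computable (A ⊗ nat) nat f →
            (∀ a → f (a , g a) ≡ 0) →
            (∀ a m → m ℕ.< g a → f (a , m) ≢ 0) →
            Computable A nat g

2^-_ : ℕ → ℚ
2^- zero  = 1ℚ
2^- suc k = ½ ℚ.* 2^- k

-- (p , m , q) represents the rational (p - m) / (q + 1).

rational : ⟦ nat ⊗ nat ⊗ nat ⟧ → ℚ
rational (p , m , q) = (p ⊖ m) ℚ./ suc q

-- φ is a computable real-valued function of the inputs satisfying P.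

ComputableReal : (A : Ty) → Pred ⟦ A ⟧ 0ℓ → (⟦ A ⟧ → ℝ) → Set
ComputableReal A P φ = ∃[ f ] Computable (A ⊗ nat) (nat ⊗ nat ⊗ nat) f ×
  (∀ a → a ∈ P → ∀ k → ∣ φ a - fromℚ (rational (f (a , k))) ∣≤ 2^- k)

------------------------------------------------------------------------
-- Computable measures on 𝒞 and computable capacities

-- A is a tree contained in {0,1}^{≤ n}.

IsTree : ℕ × List (List Bool) → Set
IsTree (n , A) = (∀ σ → σ List∈.∈ A → length σ ℕ.≤ n)
               × (∀ σ τ → (σ ++ τ) List∈.∈ A → σ List∈.∈ A)

U[_] : ℕ × List (List Bool) → Pred 𝒞 0ℓ
U[ n , A ] K = (T[ K ] ∩ (λ σ → length σ ℕ.≤ n)) ≐ (List∈._∈ A)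

IsComputableMeasure : (Pred 𝒞 0ℓ → ℝ) → Set
IsComputableMeasure ν =
  ComputableReal (list (nat ⊗ list (list bool))) (All IsTree)
    (λ As → ν (λ K → Any (λ A → K ∈ U[ A ]) As))

record IsComputableCapacity (T : Pred 2^ℕ 0ℓ → ℝ) : Set₁ where
  field
    isCapacity : IsCapacity T
    computable : ComputableReal (list (list bool)) U
      (λ σs → T (λ x → Any (λ σ → x ∈ I σ) σs))

module Submission where

-- Let E_Q be the set of codes of closed sets that meet Q.  Finitely many
-- symbols of a code determine the tree of the coded set up to any given
-- length; with compactness, E_Q is closed, hence Borel, and E turns
-- decreasing intersections of closed sets into intersections, so that
-- continuity of the capacity is continuity of μ from above.  Moreover E
-- commutes with unions, and the E-image of an intersection lies in the
-- intersection of the E-images, so that the alternating inequality is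
-- inclusion-exclusion for the events E_{Q_i}.  Finally, K meets I(σ) iff K
-- lies in U_A for some tree A ⊆ {0,1}^{≤ |σ|} containing σ, and these trees
-- can be listed computably.

open import Defs
open import Algebra.Bundles using (CommutativeMonoid)
import Algebra.Properties.CommutativeSemigroup as CommutativeSemigroup
open import Axiom.ExcludedMiddle using (ExcludedMiddle)
open import Data.Bool.Base as Bool using (Bool; true; false; if_then_else_)
import Data.Bool.Properties as Boolₚ
open import Data.Empty using (⊥-elim)
open import Data.Fin.Base using (Fin; zero; suc)
open import Data.Fin.Subset as Subset using (Subset; inside; outside)
open import Data.Fin.Subset.Properties using (nonempty?)
open import Data.List.Base as List
  using (List; []; _∷_; _++_; _∷ʳ_; length; applyUpTo; concatMap; cartesianProductWith; initLast; _∷ʳ′_)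
open import Data.List.Membership.Propositional as List∈ using (find; lose)
open import Data.List.Membership.Propositional.Properties
  using (∈-++⁺ˡ; ∈-++⁺ʳ; ∈-++⁻; ∈-∃++; ∈-map⁺; ∈-map⁻; ∈-concatMap⁺; ∈-concatMap⁻;
         ∈-cartesianProductWith⁺; ∈-cartesianProductWith⁻)
open import Data.List.Properties
  using (map-++; map-∘; map-cong; length-applyUpTo; applyUpTo-∷ʳ; length-++-comm;
         ++-assoc; ++-identityʳ; ∷-injective; ∷ʳ-injectiveˡ; ∷ʳ-injectiveʳ)
open import Data.List.Relation.Binary.Lex.Strict
  using (Lex-<; base; halt; this; next; <-transitive; <-irreflexive)
open import Data.List.Relation.Binary.Pointwise as Pointwise using (Pointwise)
open import Data.List.Relation.Unary.All as All using (All; []; _∷_)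
import Data.List.Relation.Unary.All.Properties as Allₚ
open import Data.List.Relation.Unary.AllPairs using (AllPairs; []; _∷_)
import Data.List.Relation.Unary.AllPairs.Properties as AllPairsₚ
open import Data.List.Relation.Unary.Any using (Any; here; there)
open import Data.Nat.Base as ℕ using (ℕ; zero; suc)
open import Data.Nat.Induction using (<-rec)
import Data.Nat.Properties as ℕₚ
open import Data.Product.Base using (Σ; ∃-syntax; _×_; _,_; proj₁; proj₂; swap)
open import Data.Rational.Base as ℚ using (ℚ; 0ℚ; ½)
import Data.Rational.Properties as ℚₚ
open import Data.Sum.Base using (_⊎_; inj₁; inj₂; [_,_])
open import Data.Vec.Base using ([]; _∷_; here; there)
open import Function.Base using (_∘_)
open import Level using (Lift; lift; lower; 0ℓ)
open import Relation.Binary.Bundles using (Preorder; Setoid)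
open import Relation.Binary.Definitions using (tri<; tri≈; tri>)
open import Relation.Binary.PropositionalEquality
  using (_≡_; _≢_; refl; sym; trans; cong; cong₂; subst; subst₂; isEquivalence)
import Relation.Binary.Reasoning.Preorder
import Relation.Binary.Reasoning.Setoid
open import Relation.Binary.Structures using (IsEquivalence)
open import Relation.Nullary using (¬_; Dec; yes; no)
open import Relation.Nullary.Decidable using (decidable-stable; map′)
open import Relation.Unary using
  (Pred; _∈_; _⊆_; _≐_; _≬_; _⊥_; _∩_; _∪_; ∁; ∅; U; Satisfiable; ⋃; ⋂)

-- An event is the image of a family of closed sets under coding, so a point of it comes with some
-- set that it codes, and different events may supply different sets. Two facts about the coding
-- deal with this. Every ternary sequence is a code, by breadth-first decoding: this provides a set
-- to argue about when a sequence lies outside an event, and it gives the whole space capacity 1.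
-- And a code determines its set, so that witnesses taken from infinitely many events can be moved
-- into a single closed set before compactness is applied.
--
-- On clopen sets the capacity takes exactly the values that the measure takes on clopen families.
-- Hence no new approximation of reals is made: only the translation of the input, from strings to
-- trees, has to be shown computable.

antitone : ∀ {a ℓ} {A : Set a} (E : ℕ → Pred A ℓ) → (∀ n → E (suc n) ⊆ E n) →
  ∀ {m n} → m ℕ.≤ n → E n ⊆ E m
antitone E dec m≤n = go (ℕₚ.≤⇒≤′ m≤n)
  where
  go : ∀ {m n} → m ℕ.≤′ n → E n ⊆ E m
  go ℕ.≤′-refl        x∈ = x∈
  go (ℕ.≤′-step m≤′n) x∈ = go m≤′n (dec _ x∈)

-- The ordered group of real numbers

module ℚ+ = CommutativeSemigroup (CommutativeMonoid.commutativeSemigroup ℚₚ.+-0-commutativeMonoid)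

half : ℚ → ℚ
half ε = ½ ℚ.* ε

half-pos : ∀ {ε} → 0ℚ ℚ.< ε → 0ℚ ℚ.< half ε
half-pos {ε} ε>0 = subst (ℚ._< half ε) (ℚₚ.*-zeroʳ ½) (ℚₚ.*-monoʳ-<-pos ½ ε>0)

half+half : ∀ ε → half ε ℚ.+ half ε ≡ ε
half+half ε = trans (sym (ℚₚ.*-distribʳ-+ ε ½ ½)) (ℚₚ.*-identityˡ ε)

p≤p+ε : ∀ p {ε} → 0ℚ ℚ.< ε → p ℚ.≤ p ℚ.+ ε
p≤p+ε p ε>0 = subst (ℚ._≤ p ℚ.+ _) (ℚₚ.+-identityʳ p) (ℚₚ.+-monoʳ-≤ p (ℚₚ.<⇒≤ ε>0))

-- Wrapping the relations keeps Agda from unfolding them, so that the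
-- real numbers that they relate can be inferred.
record _≲_ (x y : ℝ) : Set where
  constructor ≤⇒≲
  field ≲⇒≤ : x ≤ y

open _≲_

record _≈_ (x y : ℝ) : Set where
  constructor antisym
  field
    ≈⇒≲ : x ≲ y
    ≈⇒≳ : y ≲ x

open _≈_

infix 4 _≲_ _≈_

≃⇒≈ : ∀ {x y} → x ≃ y → x ≈ y
≃⇒≈ (p , q) = antisym (≤⇒≲ p) (≤⇒≲ q)

≈⇒≃ : ∀ {x y} → x ≈ y → x ≃ y
≈⇒≃ (antisym (≤⇒≲ p) (≤⇒≲ q)) = p , q

pointwise⇒≲ : ∀ {x y} → (∀ n → seq x n ≡ seq y n) → x ≲ y
pointwise⇒≲ {x} {y} eq = ≤⇒≲ λ ε ε>0 → 0 , λ n _ →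
  subst (ℚ._≤ seq y n ℚ.+ ε) (sym (eq n)) (p≤p+ε (seq y n) ε>0)

pointwise⇒≈ : ∀ {x y} → (∀ n → seq x n ≡ seq y n) → x ≈ y
pointwise⇒≈ eq = antisym (pointwise⇒≲ eq) (pointwise⇒≲ λ n → sym (eq n))

≲-trans : ∀ {x y z} → x ≲ y → y ≲ z → x ≲ z
≲-trans {x} {y} {z} (≤⇒≲ x≤y) (≤⇒≲ y≤z) = ≤⇒≲ λ ε ε>0 →
  let (M , p) = x≤y (half ε) (half-pos ε>0)
      (N , q) = y≤z (half ε) (half-pos ε>0)
  in M ℕ.⊔ N , λ n n≥ → let open ℚₚ.≤-Reasoning in begin
    seq x n                          ≤⟨ p n (ℕₚ.m⊔n≤o⇒m≤o M N n≥) ⟩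
    seq y n ℚ.+ half ε               ≤⟨ ℚₚ.+-monoˡ-≤ (half ε) (q n (ℕₚ.m⊔n≤o⇒n≤o M N n≥)) ⟩
    seq z n ℚ.+ half ε ℚ.+ half ε    ≡⟨ ℚₚ.+-assoc (seq z n) _ _ ⟩
    seq z n ℚ.+ (half ε ℚ.+ half ε)  ≡⟨ cong (seq z n ℚ.+_) (half+half ε) ⟩
    seq z n ℚ.+ ε                    ∎

≈-isEquivalence : IsEquivalence _≈_
≈-isEquivalence = record
  { refl  = pointwise⇒≈ λ _ → refl
  ; sym   = λ (antisym p q) → antisym q p
  ; trans = λ (antisym p p′) (antisym q q′) → antisym (≲-trans p q) (≲-trans q′ p′)
  }

module ≈ = IsEquivalence ≈-isEquivalence

≈-setoid : Setoid _ _
≈-setoid = record { isEquivalence = ≈-isEquivalence }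

module ≈-Reasoning = Relation.Binary.Reasoning.Setoid ≈-setoid

≲-preorder : Preorder _ _ _
≲-preorder = record
  { isPreorder = record
    { isEquivalence = ≈-isEquivalence
    ; reflexive     = ≈⇒≲
    ; trans         = ≲-trans
    }
  }

module ≲-Reasoning = Relation.Binary.Reasoning.Preorder ≲-preorder

≲-refl : ∀ {x} → x ≲ x
≲-refl = Preorder.refl ≲-preorder

infixl 6 _⊕_
infix  8 ⊖_

-- Opaque copies of the operations: unfolding _+_ would expose the Cauchy
-- moduli of sums, and comparing those is prohibitively slow.
opaque

  _⊕_ : ℝ → ℝ → ℝ
  _⊕_ = _+_

  ⊖_ : ℝ → ℝ
  ⊖_ = -_

  +≡⊕ : ∀ x y → x + y ≡ x ⊕ y
  +≡⊕ x y = refl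

  -≡⊖ : ∀ x → - x ≡ ⊖ x
  -≡⊖ x = refl

  ≤+⇒≲⊕ : ∀ {x y z} → x ≤ y + z → x ≲ y ⊕ z
  ≤+⇒≲⊕ = ≤⇒≲

  ≲⊕⇒≤+ : ∀ {x y z} → x ≲ y ⊕ z → x ≤ y + z
  ≲⊕⇒≤+ = ≲⇒≤

  ≲-fromℚ : ∀ {x y} → (∀ ε → 0ℚ ℚ.< ε → x ≲ y ⊕ fromℚ ε) → x ≲ y
  ≲-fromℚ {x} {y} h = ≤⇒≲ λ ε ε>0 →
    let (N , p) = ≲⇒≤ (h (half ε) (half-pos ε>0)) (half ε) (half-pos ε>0)
    in N , λ n n≥ → subst (seq x n ℚ.≤_)
         (trans (ℚₚ.+-assoc (seq y n) _ _) (cong (seq y n ℚ.+_) (half+half ε))) (p n n≥)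

  ⊕-mono-≲ : ∀ {x y u v} → x ≲ y → u ≲ v → x ⊕ u ≲ y ⊕ v
  ⊕-mono-≲ {x} {y} {u} {v} (≤⇒≲ x≤y) (≤⇒≲ u≤v) = ≤⇒≲ λ ε ε>0 →
    let (M , p) = x≤y (half ε) (half-pos ε>0)
        (N , q) = u≤v (half ε) (half-pos ε>0)
    in M ℕ.⊔ N , λ n n≥ → let open ℚₚ.≤-Reasoning in begin
      seq x n ℚ.+ seq u n
        ≤⟨ ℚₚ.+-mono-≤ (p n (ℕₚ.m⊔n≤o⇒m≤o M N n≥)) (q n (ℕₚ.m⊔n≤o⇒n≤o M N n≥)) ⟩
      seq y n ℚ.+ half ε ℚ.+ (seq v n ℚ.+ half ε)
        ≡⟨ ℚ+.interchange (seq y n) _ _ _ ⟩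
      seq y n ℚ.+ seq v n ℚ.+ (half ε ℚ.+ half ε)
        ≡⟨ cong (seq y n ℚ.+ seq v n ℚ.+_) (half+half ε) ⟩
      seq y n ℚ.+ seq v n ℚ.+ ε
        ∎

  ⊕-assoc : ∀ x y z → (x ⊕ y) ⊕ z ≈ x ⊕ (y ⊕ z)
  ⊕-assoc x y z = pointwise⇒≈ λ n → ℚₚ.+-assoc (seq x n) (seq y n) (seq z n)

  ⊕-comm : ∀ x y → x ⊕ y ≈ y ⊕ x
  ⊕-comm x y = pointwise⇒≈ λ n → ℚₚ.+-comm (seq x n) (seq y n)

  ⊕-identityˡ : ∀ x → 0ℝ ⊕ x ≈ x
  ⊕-identityˡ x = pointwise⇒≈ λ n → ℚₚ.+-identityˡ (seq x n)

  ⊖-inverseʳ : ∀ x → x ⊕ ⊖ x ≈ 0ℝ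
  ⊖-inverseʳ x = pointwise⇒≈ λ n → ℚₚ.+-inverseʳ (seq x n)

⊕-cong : ∀ {x y u v} → x ≈ y → u ≈ v → x ⊕ u ≈ y ⊕ v
⊕-cong (antisym p p′) (antisym q q′) = antisym (⊕-mono-≲ p q) (⊕-mono-≲ p′ q′)

⊕-identityʳ : ∀ x → x ⊕ 0ℝ ≈ x
⊕-identityʳ x = ≈.trans (⊕-comm x 0ℝ) (⊕-identityˡ x)

⊖-inverseˡ : ∀ x → ⊖ x ⊕ x ≈ 0ℝ
⊖-inverseˡ x = ≈.trans (⊕-comm (⊖ x) x) (⊖-inverseʳ x)

⊕-cancelˡ-≲ : ∀ z {x y} → z ⊕ x ≲ z ⊕ y → x ≲ y
⊕-cancelˡ-≲ z {x} {y} h = begin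
  x              ≈⟨ cancel x ⟨
  ⊖ z ⊕ (z ⊕ x)  ≲⟨ ⊕-mono-≲ ≲-refl h ⟩
  ⊖ z ⊕ (z ⊕ y)  ≈⟨ cancel y ⟩
  y              ∎
  where
  open ≲-Reasoning
  cancel : ∀ w → ⊖ z ⊕ (z ⊕ w) ≈ w
  cancel w = ≈.trans (≈.sym (⊕-assoc (⊖ z) z w))
    (≈.trans (⊕-cong (⊖-inverseˡ z) ≈.refl) (⊕-identityˡ w))

⊕-cancelˡ-≈ : ∀ z {x y} → z ⊕ x ≈ z ⊕ y → x ≈ y
⊕-cancelˡ-≈ z (antisym p q) = antisym (⊕-cancelˡ-≲ z p) (⊕-cancelˡ-≲ z q)

⊖-involutive : ∀ x → ⊖ ⊖ x ≈ x
⊖-involutive x = ⊕-cancelˡ-≈ (⊖ x) (≈.trans (⊖-inverseʳ (⊖ x)) (≈.sym (⊖-inverseˡ x)))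

⊖-cong : ∀ {x y} → x ≈ y → ⊖ x ≈ ⊖ y
⊖-cong {x} {y} x≈y = ⊕-cancelˡ-≈ x (≈.trans (⊖-inverseʳ x)
  (≈.trans (≈.sym (⊖-inverseʳ y)) (⊕-cong (≈.sym x≈y) ≈.refl)))

⊖-zero : ⊖ 0ℝ ≈ 0ℝ
⊖-zero = ≈.trans (≈.sym (⊕-identityˡ (⊖ 0ℝ))) (⊖-inverseʳ 0ℝ)

⊖-distrib-⊕ : ∀ x y → ⊖ (x ⊕ y) ≈ ⊖ x ⊕ ⊖ y
⊖-distrib-⊕ x y = ⊕-cancelˡ-≈ (x ⊕ y) (begin
  (x ⊕ y) ⊕ ⊖ (x ⊕ y)    ≈⟨ ⊖-inverseʳ (x ⊕ y) ⟩
  0ℝ                     ≈⟨ ⊖-inverseʳ x ⟨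
  x ⊕ ⊖ x                ≈⟨ ⊕-cong ≈.refl (⊕-identityˡ (⊖ x)) ⟨
  x ⊕ (0ℝ ⊕ ⊖ x)         ≈⟨ ⊕-cong ≈.refl (⊕-cong (⊖-inverseʳ y) ≈.refl) ⟨
  x ⊕ ((y ⊕ ⊖ y) ⊕ ⊖ x)  ≈⟨ ⊕-cong ≈.refl (⊕-assoc y (⊖ y) (⊖ x)) ⟩
  x ⊕ (y ⊕ (⊖ y ⊕ ⊖ x))  ≈⟨ ⊕-assoc x y (⊖ y ⊕ ⊖ x) ⟨
  (x ⊕ y) ⊕ (⊖ y ⊕ ⊖ x)  ≈⟨ ⊕-cong ≈.refl (⊕-comm (⊖ y) (⊖ x)) ⟩
  (x ⊕ y) ⊕ (⊖ x ⊕ ⊖ y)  ∎)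
  where open ≈-Reasoning

⊖x⊕[y⊕x]≈y : ∀ x y → ⊖ x ⊕ (y ⊕ x) ≈ y
⊖x⊕[y⊕x]≈y x y = begin
  ⊖ x ⊕ (y ⊕ x)  ≈⟨ ⊕-comm (⊖ x) (y ⊕ x) ⟩
  (y ⊕ x) ⊕ ⊖ x  ≈⟨ ⊕-assoc y x (⊖ x) ⟩
  y ⊕ (x ⊕ ⊖ x)  ≈⟨ ⊕-cong ≈.refl (⊖-inverseʳ x) ⟩
  y ⊕ 0ℝ         ≈⟨ ⊕-identityʳ y ⟩
  y              ∎
  where open ≈-Reasoning

limit-eventually-constant : ∀ {a x c} → ConvergesTo a x →
  ∀ N → (∀ n → N ℕ.≤ n → a n ≈ c) → x ≈ c
limit-eventually-constant {a} {x} {c} lim N const = antisym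
  (≲-fromℚ λ ε ε>0 → let (M , h) = lim ε ε>0 ; n = M ℕ.⊔ N in
    ≲-trans (≤+⇒≲⊕ (proj₂ (h n (ℕₚ.m≤m⊔n M N))))
            (⊕-mono-≲ (≈⇒≲ (const n (ℕₚ.m≤n⊔m M N))) ≲-refl))
  (≲-fromℚ λ ε ε>0 → let (M , h) = lim ε ε>0 ; n = M ℕ.⊔ N in
    ≲-trans (≈⇒≳ (const n (ℕₚ.m≤n⊔m M N))) (≤+⇒≲⊕ (proj₁ (h n (ℕₚ.m≤m⊔n M N)))))

within-congˡ : ∀ {x y z ε} → x ≈ y → ∣ x - z ∣≤ ε → ∣ y - z ∣≤ ε
within-congˡ {x} {y} {z} {ε} x≈y (lo , hi) =
  ≲⊕⇒≤+ {y} {z} {fromℚ ε} (≲-trans (≈⇒≳ x≈y) (≤+⇒≲⊕ lo)) ,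
  ≲⊕⇒≤+ {z} {y} {fromℚ ε} (≲-trans (≤+⇒≲⊕ {z} {x} {fromℚ ε} hi) (⊕-mono-≲ (≈⇒≲ x≈y) ≲-refl))

limit-cong : ∀ {a x y} → x ≈ y → ConvergesTo a x → ConvergesTo a y
limit-cong {a} {x} {y} x≈y lim ε ε>0 = let (N , h) = lim ε ε>0 in
  N , λ n n≥ → swap (within-congˡ {x} {y} {a n} x≈y (swap (h n n≥)))

-- Phrased with sums equal to a fixed `c` in place of subtraction. In continuity from above, `a` is
-- the mass removed before stage `n`, `b` the mass that remains, and `c` the mass of the first set.
limit-complement : ∀ {a b x y c} → ConvergesTo a x →
  (∀ n → a n ⊕ b n ≈ c) → x ⊕ y ≈ c → ConvergesTo b y
limit-complement {a} {b} {x} {y} {c} lim sums sum ε ε>0 =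
  let (N , h) = lim ε ε>0 in N , λ n n≥ →
    ≲⊕⇒≤+ (compare (≤+⇒≲⊕ (proj₂ (h n n≥))) (sums n) sum) ,
    ≲⊕⇒≤+ (compare (≤+⇒≲⊕ (proj₁ (h n n≥))) sum (sums n))
  where
  compare : ∀ {p q r s} → q ≲ p ⊕ fromℚ ε → p ⊕ r ≈ c → q ⊕ s ≈ c → r ≲ s ⊕ fromℚ ε
  compare {p} {q} {r} {s} q≲p⊕ε p⊕r q⊕s = ⊕-cancelˡ-≲ p (begin
    p ⊕ r                ≈⟨ p⊕r ⟩
    c                    ≈⟨ q⊕s ⟨
    q ⊕ s                ≲⟨ ⊕-mono-≲ q≲p⊕ε ≲-refl ⟩
    (p ⊕ fromℚ ε) ⊕ s    ≈⟨ ⊕-assoc p (fromℚ ε) s ⟩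
    p ⊕ (fromℚ ε ⊕ s)    ≈⟨ ⊕-cong ≈.refl (⊕-comm (fromℚ ε) s) ⟩
    p ⊕ (s ⊕ fromℚ ε)    ∎)
    where open ≲-Reasoning

⨁ : List ℝ → ℝ
⨁ = List.foldr _⊕_ 0ℝ

sum≡⨁ : ∀ xs → sum xs ≡ ⨁ xs
sum≡⨁ []       = refl
sum≡⨁ (x ∷ xs) = trans (+≡⊕ x (sum xs)) (cong (x ⊕_) (sum≡⨁ xs))

signed : ℕ → ℝ → ℝ
signed zero    x = x
signed (suc k) x = ⊖ signed k x

-1^≡signed : ∀ k x → -1^ k · x ≡ signed k x
-1^≡signed zero    x = refl
-1^≡signed (suc k) x = trans (-≡⊖ (-1^ k · x)) (cong ⊖_ (-1^≡signed k x))

signed-cong : ∀ k {x y} → x ≈ y → signed k x ≈ signed k y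
signed-cong zero    eq = eq
signed-cong (suc k) eq = ⊖-cong (signed-cong k eq)

signed-zero : ∀ k {x} → x ≈ 0ℝ → signed k x ≈ 0ℝ
signed-zero zero    eq = eq
signed-zero (suc k) eq = ≈.trans (⊖-cong (signed-zero k eq)) ⊖-zero

⨁-++ : ∀ xs ys → ⨁ (xs ++ ys) ≈ ⨁ xs ⊕ ⨁ ys
⨁-++ []       ys = ≈.sym (⊕-identityˡ (⨁ ys))
⨁-++ (x ∷ xs) ys = ≈.trans (⊕-cong ≈.refl (⨁-++ xs ys)) (≈.sym (⊕-assoc x (⨁ xs) (⨁ ys)))

module _ {A : Set} where

  ⨁-cong : {f g : A → ℝ} → (∀ a → f a ≈ g a) → ∀ as → ⨁ (List.map f as) ≈ ⨁ (List.map g as)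
  ⨁-cong eq []       = ≈.refl
  ⨁-cong eq (a ∷ as) = ⊕-cong (eq a) (⨁-cong eq as)

  ⨁-⊖ : (f : A → ℝ) → ∀ as → ⨁ (List.map (λ a → ⊖ f a) as) ≈ ⊖ ⨁ (List.map f as)
  ⨁-⊖ f []       = ≈.sym ⊖-zero
  ⨁-⊖ f (a ∷ as) = ≈.trans (⊕-cong ≈.refl (⨁-⊖ f as))
    (≈.sym (⊖-distrib-⊕ (f a) (⨁ (List.map f as))))

  -- Capacities sum over nonempty subsets, but only the list of all subsets splits recursively. The
  -- additional term belongs to an empty union and vanishes.
  ⨁-filter : {P : A → Set} (P? : ∀ a → Dec (P a)) (f : A → ℝ) → (∀ a → ¬ P a → f a ≈ 0ℝ) →
    ∀ as → ⨁ (List.map f (List.filter P? as)) ≈ ⨁ (List.map f as)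
  ⨁-filter P? f zero-outside []       = ≈.refl
  ⨁-filter P? f zero-outside (a ∷ as) with P? a
  ... | yes _ = ⊕-cong ≈.refl (⨁-filter P? f zero-outside as)
  ... | no ¬p = ≈.trans (⨁-filter P? f zero-outside as)
    (≈.trans (≈.sym (⊕-identityˡ _)) (⊕-cong (≈.sym (zero-outside a ¬p)) ≈.refl))

-- Finite additivity, continuity from above and inclusion-exclusion

infixl 7 _∖_

_∖_ : ∀ {A : Set} → Pred A 1ℓ → Pred A 1ℓ → Pred A 1ℓ
B ∖ C = B ∩ ∁ C

module Measure (em : ExcludedMiddle 1ℓ) {A : Set}
  {μ : Pred (ℕ → A) 1ℓ → ℝ} (isProbability : IsBorelProbability μ) where

  open IsBorelProbability isProbability

  private variable
    B C D : Pred (ℕ → A) 1ℓ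

  μ-cong : IsBorel B → IsBorel C → B ≐ C → μ B ≈ μ C
  μ-cong bB bC B≐C = ≃⇒≈ (cong-≐ bB bC B≐C)

  ↑∅-borel : IsBorel {A} (↑ ∅)
  ↑∅-borel = open-set λ x ()

  μ-∅ : μ (↑ ∅) ≈ 0ℝ
  μ-∅ = ≃⇒≈ empty

  μ-U : μ (↑ U) ≈ 1ℝ
  μ-U = ≃⇒≈ total

  pair-sequence : Pred (ℕ → A) 1ℓ → Pred (ℕ → A) 1ℓ → ℕ → Pred (ℕ → A) 1ℓ
  pair-sequence B C 0             = B
  pair-sequence B C 1             = C
  pair-sequence B C (suc (suc _)) = ↑ ∅

  pair-sequence-borel : IsBorel B → IsBorel C → ∀ n → IsBorel (pair-sequence B C n)
  pair-sequence-borel bB bC 0             = bB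
  pair-sequence-borel bB bC 1             = bC
  pair-sequence-borel bB bC (suc (suc _)) = ↑∅-borel

  ⋃-pair-sequence : ⋃ ℕ (pair-sequence B C) ≐ B ∪ C
  ⋃-pair-sequence =
      (λ { (0 , x∈) → inj₁ x∈ ; (1 , x∈) → inj₂ x∈ ; (suc (suc _) , lift ()) })
    , λ { (inj₁ x∈) → 0 , x∈ ; (inj₂ x∈) → 1 , x∈ }

  ∪-borel : IsBorel B → IsBorel C → IsBorel (B ∪ C)
  ∪-borel bB bC = respects-≐ ⋃-pair-sequence (union (pair-sequence-borel bB bC))

  ∩-borel : IsBorel B → IsBorel C → IsBorel (B ∩ C)
  ∩-borel {B} {C} bB bC = respects-≐
    ( (λ {x} x∉ → decidable-stable em (x∉ ∘ inj₁) , decidable-stable em (x∉ ∘ inj₂))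
    , λ { (x∈B , x∈C) → [ (λ x∉B → x∉B x∈B) , (λ x∉C → x∉C x∈C) ] })
    (complement (∪-borel (complement bB) (complement bC)))

  ∖-borel : IsBorel B → IsBorel C → IsBorel (B ∖ C)
  ∖-borel bB bC = ∩-borel bB (complement bC)

  ⋂-borel : ∀ {n} {E : Fin n → Pred (ℕ → A) 1ℓ} → (∀ i → IsBorel (E i)) → IsBorel (⋂ (Fin n) E)
  ⋂-borel {zero}  bE = respects-≐ ((λ _ ()) , λ _ → lift _) (open-set {G = ↑ U} λ x _ → 0 , λ _ → lift _)
  ⋂-borel {suc n} bE = respects-≐
    ((λ { (x∈ , _) zero → x∈ ; (_ , x∈) (suc i) → x∈ i }) , λ x∈ → x∈ zero , x∈ ∘ suc)
    (∩-borel (bE zero) (⋂-borel (bE ∘ suc)))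

  ⋂ℕ-borel : {E : ℕ → Pred (ℕ → A) 1ℓ} → (∀ n → IsBorel (E n)) → IsBorel (⋂ ℕ E)
  ⋂ℕ-borel bE = respects-≐
    ((λ x∉ n → decidable-stable em λ x∉E → x∉ (n , x∉E)) , λ x∈ (n , x∉) → x∉ (x∈ n))
    (complement (union (λ n → complement (bE n))))

  μ-∪ : IsBorel B → IsBorel C → B ⊥ C → μ (B ∪ C) ≈ μ B ⊕ μ C
  μ-∪ {B} {C} bB bC B⊥C = ≈.trans
    (μ-cong (∪-borel bB bC) (union borel) (proj₂ ⋃-pair-sequence , proj₁ ⋃-pair-sequence))
    -- Countable additivity is applied to `B`, `C`, ∅, ∅, ...; from index 2 on the partial sums only
    -- gain zeros.
    (limit-eventually-constant (additive (pair-sequence B C) borel disjoint) 2 partial-sum)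
    where
    borel = pair-sequence-borel bB bC

    disjoint : ∀ m n → m ≢ n → pair-sequence B C m ⊥ pair-sequence B C n
    disjoint 0 0 m≢n _ = m≢n refl
    disjoint 0 1 m≢n x∈ = B⊥C x∈
    disjoint 1 0 m≢n (x∈C , x∈B) = B⊥C (x∈B , x∈C)
    disjoint 1 1 m≢n _ = m≢n refl
    disjoint 0 (suc (suc n)) m≢n (_ , lift ())
    disjoint 1 (suc (suc n)) m≢n (_ , lift ())
    disjoint (suc (suc m)) n m≢n (lift () , _)

    zeros : ∀ k → ⨁ (applyUpTo (λ _ → μ (↑ ∅)) k) ≈ 0ℝ
    zeros zero    = ≈.refl
    zeros (suc k) = ≈.trans (⊕-cong μ-∅ (zeros k)) (⊕-identityˡ 0ℝ)

    partial-sum : ∀ n → 2 ℕ.≤ n → sum (applyUpTo (μ ∘ pair-sequence B C) n) ≈ μ B ⊕ μ C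
    partial-sum (suc (suc k)) _ = ≈.trans
      (≈.reflexive (sum≡⨁ (applyUpTo (μ ∘ pair-sequence B C) (suc (suc k)))))
      (⊕-cong ≈.refl (≈.trans (⊕-cong ≈.refl (zeros k)) (⊕-identityʳ (μ C))))
    partial-sum 1 (ℕ.s≤s ())

  μ-∖ : IsBorel B → IsBorel C → C ⊆ B → μ (B ∖ C) ⊕ μ C ≈ μ B
  μ-∖ {B} {C} bB bC C⊆B = ≈.trans
    (≈.sym (μ-∪ (∖-borel bB bC) bC λ ((_ , x∉C) , x∈C) → x∉C x∈C))
    (μ-cong (∪-borel (∖-borel bB bC) bC) bB ([ proj₁ , C⊆B ] , λ {x} → by-cases {x} em))
    where
    by-cases : ∀ {x} → Dec (x ∈ C) → x ∈ B → x ∈ (B ∖ C) ∪ C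
    by-cases (yes x∈C) _   = inj₂ x∈C
    by-cases (no  x∉C) x∈B = inj₁ (x∈B , x∉C)

  μ-mono : IsBorel B → IsBorel C → C ⊆ B → μ C ≲ μ B
  μ-mono {B} {C} bB bC C⊆B = begin
    μ C                  ≈⟨ ≈.sym (⊕-identityˡ (μ C)) ⟩
    0ℝ ⊕ μ C             ≲⟨ ⊕-mono-≲ (≤⇒≲ (nonneg (∖-borel bB bC))) (≲-refl {μ C}) ⟩
    μ (B ∖ C) ⊕ μ C      ≈⟨ μ-∖ bB bC C⊆B ⟩
    μ B                  ∎
    where open ≲-Reasoning

  module _ {E : ℕ → Pred (ℕ → A) 1ℓ} (bE : ∀ n → IsBorel (E n)) (dec : ∀ n → E (suc n) ⊆ E n) where

    private
      ring : ℕ → Pred (ℕ → A) 1ℓ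
      ring n = E n ∖ E (suc n)

      ring-disjoint : ∀ m n → m ≢ n → ring m ⊥ ring n
      ring-disjoint m n m≢n ((x∈Em , x∉Em⁺) , (x∈En , x∉En⁺)) with ℕₚ.<-cmp m n
      ... | tri< m<n _ _ = x∉Em⁺ (antitone E dec m<n x∈En)
      ... | tri≈ _ m≡n _ = m≢n m≡n
      ... | tri> _ _ n<m = x∉En⁺ (antitone E dec n<m x∈Em)

      never-leaves : ∀ {x} → ¬ (∃[ n ] x ∈ ring n) → x ∈ E 0 → ∀ n → x ∈ E n
      never-leaves ¬leaves x∈ zero    = x∈
      never-leaves ¬leaves x∈ (suc n) = decidable-stable em λ x∉ →
        ¬leaves (n , never-leaves ¬leaves x∈ n , x∉)

      rings∪core : ⋃ ℕ ring ∪ ⋂ ℕ E ≐ E 0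
      rings∪core = [ (λ (n , x∈ , _) → antitone E dec ℕ.z≤n x∈) , (λ x∈ → x∈ 0) ] , λ {x} → by-cases {x} em
        where
        by-cases : ∀ {x} → Dec (∃[ n ] x ∈ ring n) → x ∈ E 0 → x ∈ ⋃ ℕ ring ∪ ⋂ ℕ E
        by-cases (yes leaves) _  = inj₁ leaves
        by-cases (no ¬leaves) x∈ = inj₂ (never-leaves ¬leaves x∈)

    -- `E 0` is the disjoint union of the rings and of the intersection: a point that leaves the
    -- sequence does so through a ring. The masses of the first `n` rings and of `E n` add up to
    -- that of `E 0`, so convergence of the ring sums forces convergence of what remains.
    μ-⋂-continuous : ConvergesTo (μ ∘ E) (μ (⋂ ℕ E))
    μ-⋂-continuous = limit-complement (additive ring ring-borel ring-disjoint)
      (λ n → ≈.trans (⊕-cong (≈.reflexive (sum≡⨁ (applyUpTo (μ ∘ ring) n))) ≈.refl)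
                     (telescope n E bE dec))
      (≈.trans (≈.sym (μ-∪ (union ring-borel) (⋂ℕ-borel bE) λ ((n , _ , x∉) , x∈) → x∉ (x∈ (suc n))))
        (μ-cong (∪-borel (union ring-borel) (⋂ℕ-borel bE)) (bE 0) rings∪core))
      where
      ring-borel : ∀ n → IsBorel (ring n)
      ring-borel n = ∖-borel (bE n) (bE (suc n))

      -- Generalised over the sequence, since removing the first ring leaves the same claim for
      -- `E ∘ suc`.
      telescope : ∀ n (E : ℕ → Pred (ℕ → A) 1ℓ) → (∀ n → IsBorel (E n)) → (∀ n → E (suc n) ⊆ E n) →
        ⨁ (applyUpTo (λ k → μ (E k ∖ E (suc k))) n) ⊕ μ (E n) ≈ μ (E 0)
      telescope zero    E bE dec = ⊕-identityˡ (μ (E 0))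
      telescope (suc n) E bE dec = begin
        (r ⊕ rest) ⊕ μ (E (suc n))  ≈⟨ ⊕-assoc r rest (μ (E (suc n))) ⟩
        r ⊕ (rest ⊕ μ (E (suc n)))  ≈⟨ ⊕-cong ≈.refl (telescope n (E ∘ suc) (bE ∘ suc) (dec ∘ suc)) ⟩
        r ⊕ μ (E 1)                 ≈⟨ μ-∖ (bE 0) (bE 1) (dec 0) ⟩
        μ (E 0)                     ∎
        where
        open ≈-Reasoning
        r    = μ (E 0 ∖ E 1)
        rest = ⨁ (applyUpTo (λ k → μ (E (suc k) ∖ E (suc (suc k)))) n)

  -- Inclusion-exclusion is proved relative to a set D that is removed from
  -- the intersection, since splitting the subsets of Fin (suc n) according
  -- to whether they contain zero replaces D by D ∪ E zero in one half.
  join : ∀ {n} → Pred (ℕ → A) 1ℓ → Subset n → (Fin n → Pred (ℕ → A) 1ℓ) → Pred (ℕ → A) 1ℓ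
  join D []            E = D
  join D (outside ∷ J) E = join D J (E ∘ suc)
  join D (inside  ∷ J) E = join (D ∪ E zero) J (E ∘ suc)

  join-borel : ∀ {n} → IsBorel D → (J : Subset n) {E : Fin n → Pred (ℕ → A) 1ℓ} →
    (∀ i → IsBorel (E i)) → IsBorel (join D J E)
  join-borel bD []            bE = bD
  join-borel bD (outside ∷ J) bE = join-borel bD J (bE ∘ suc)
  join-borel bD (inside  ∷ J) bE = join-borel (∪-borel bD (bE zero)) J (bE ∘ suc)

  alternatingSum : ∀ {n} → Pred (ℕ → A) 1ℓ → (Fin n → Pred (ℕ → A) 1ℓ) → ℝ
  alternatingSum {n} D E = ⨁ (List.map (λ J → signed (suc Subset.∣ J ∣) (μ (join D J E))) (subsets n))

  alternatingSum-suc : ∀ {n} D (E : Fin (suc n) → Pred (ℕ → A) 1ℓ) →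
    alternatingSum D E ≈ alternatingSum D (E ∘ suc) ⊕ ⊖ alternatingSum (D ∪ E zero) (E ∘ suc)
  alternatingSum-suc {n} D E = begin
    ⨁ (List.map t (List.map (outside ∷_) js ++ List.map (inside ∷_) js))
      ≈⟨ ≈.reflexive (cong ⨁ (trans (map-++ t (List.map (outside ∷_) js) _)
           (cong₂ _++_ (sym (map-∘ js)) (sym (map-∘ js))))) ⟩
    ⨁ (List.map (t ∘ (outside ∷_)) js ++ List.map (t ∘ (inside ∷_)) js)
      ≈⟨ ⨁-++ (List.map (t ∘ (outside ∷_)) js) (List.map (t ∘ (inside ∷_)) js) ⟩
    alternatingSum D (E ∘ suc) ⊕ ⨁ (List.map (t ∘ (inside ∷_)) js)
      -- `inside ∷ J` has one element more than `J`, so each of its terms carries one further `⊖` by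
      -- computation.
      ≈⟨ ⊕-cong ≈.refl (⨁-⊖ (λ J → signed (suc Subset.∣ J ∣) (μ (join (D ∪ E zero) J (E ∘ suc)))) js) ⟩
    alternatingSum D (E ∘ suc) ⊕ ⊖ alternatingSum (D ∪ E zero) (E ∘ suc)
      ∎
    where
    open ≈-Reasoning
    js = subsets n
    t : Subset (suc n) → ℝ
    t J = signed (suc Subset.∣ J ∣) (μ (join D J E))

  -- The two halves of the sum are the masses of `rest` without `D` and of `rest` without
  -- `D ∪ E zero`; their difference is the mass of the part of `rest` inside `E zero` and outside
  -- `D`. The induction starts at one set: for an empty family the sum is `⊖ μ D`, while the
  -- complement of `D` has mass larger by 1.
  alternatingSum-⋂ : ∀ {n} {D} {E : Fin (suc n) → Pred (ℕ → A) 1ℓ} → IsBorel D → (∀ i → IsBorel (E i)) →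
    alternatingSum D E ≈ μ (⋂ (Fin (suc n)) E ∖ D)
  alternatingSum-⋂ {zero} {D} {E} bD bE = begin
    alternatingSum D E
      ≈⟨ alternatingSum-suc D E ⟩
    (⊖ μ D ⊕ 0ℝ) ⊕ ⊖ (⊖ μ (D ∪ E zero) ⊕ 0ℝ)
      ≈⟨ ⊕-cong (⊕-identityʳ (⊖ μ D))
           (≈.trans (⊖-cong (⊕-identityʳ (⊖ μ (D ∪ E zero)))) (⊖-involutive (μ (D ∪ E zero)))) ⟩
    ⊖ μ D ⊕ μ (D ∪ E zero)
      ≈⟨ ⊕-cong ≈.refl (≈.sym (μ-∖ (∪-borel bD (bE zero)) bD inj₁)) ⟩
    ⊖ μ D ⊕ (μ ((D ∪ E zero) ∖ D) ⊕ μ D)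
      ≈⟨ ⊖x⊕[y⊕x]≈y (μ D) (μ ((D ∪ E zero) ∖ D)) ⟩
    μ ((D ∪ E zero) ∖ D)
      ≈⟨ μ-cong (∖-borel (∪-borel bD (bE zero)) bD) (∖-borel (⋂-borel bE) bD)
           ( (λ { (inj₁ x∈D , x∉D) → ⊥-elim (x∉D x∈D) ; (inj₂ x∈E , x∉D) → (λ { zero → x∈E }) , x∉D })
           , λ (x∈ , x∉D) → inj₂ (x∈ zero) , x∉D) ⟩
    μ (⋂ (Fin 1) E ∖ D)
      ∎
    where open ≈-Reasoning
  alternatingSum-⋂ {suc n} {D} {E} bD bE = begin
    alternatingSum D E
      ≈⟨ alternatingSum-suc D E ⟩
    alternatingSum D E′ ⊕ ⊖ alternatingSum (D ∪ E zero) E′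
      ≈⟨ ⊕-cong (alternatingSum-⋂ bD (bE ∘ suc))
           (⊖-cong (alternatingSum-⋂ (∪-borel bD (bE zero)) (bE ∘ suc))) ⟩
    μ (rest ∖ D) ⊕ ⊖ μ (rest ∖ (D ∪ E zero))
      ≈⟨ ⊕-comm (μ (rest ∖ D)) (⊖ μ (rest ∖ (D ∪ E zero))) ⟩
    ⊖ μ (rest ∖ (D ∪ E zero)) ⊕ μ (rest ∖ D)
      ≈⟨ ⊕-cong ≈.refl (≈.sym (μ-∖ rest∖D-borel rest∖D∪E-borel
           λ (x∈ , x∉) → x∈ , x∉ ∘ inj₁)) ⟩
    ⊖ μ (rest ∖ (D ∪ E zero)) ⊕ (μ (rest ∖ D ∖ (rest ∖ (D ∪ E zero))) ⊕ μ (rest ∖ (D ∪ E zero)))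
      ≈⟨ ⊖x⊕[y⊕x]≈y (μ (rest ∖ (D ∪ E zero))) (μ (rest ∖ D ∖ (rest ∖ (D ∪ E zero)))) ⟩
    μ (rest ∖ D ∖ (rest ∖ (D ∪ E zero)))
      ≈⟨ μ-cong (∖-borel rest∖D-borel rest∖D∪E-borel) (∖-borel (⋂-borel bE) bD)
           ( (λ ((x∈ , x∉D) , x∉) →
               (λ { zero → decidable-stable em λ x∉E → x∉ (x∈ , [ x∉D , x∉E ]) ; (suc i) → x∈ i }) , x∉D)
           , λ (x∈ , x∉D) → (x∈ ∘ suc , x∉D) , λ (_ , x∉) → x∉ (inj₂ (x∈ zero))) ⟩
    μ (⋂ (Fin (suc (suc n))) E ∖ D)
      ∎
    where
    open ≈-Reasoning
    E′ = E ∘ suc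
    rest = ⋂ (Fin (suc n)) E′
    rest∖D-borel : IsBorel (rest ∖ D)
    rest∖D-borel = ∖-borel (⋂-borel (bE ∘ suc)) bD
    rest∖D∪E-borel : IsBorel (rest ∖ (D ∪ E zero))
    rest∖D∪E-borel = ∖-borel (⋂-borel (bE ∘ suc)) (∪-borel bD (bE zero))

-- Compactness of Cantor space and locality of codes

∷ʳ-length : ∀ {A : Set} (σ : List A) b → length (σ ∷ʳ b) ≡ suc (length σ)
∷ʳ-length σ b = length-++-comm σ (b ∷ [])

module _ {A : Set} where

  applyUpTo-∈I : (x : ℕ → A) → ∀ n → I (applyUpTo x n) x
  applyUpTo-∈I x n = cong (applyUpTo x) (length-applyUpTo x n)

  I-applyUpTo : ∀ {x y : ℕ → A} n → y ∈ I (applyUpTo x n) → applyUpTo y n ≡ applyUpTo x n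
  I-applyUpTo {x} {y} n = subst (λ k → applyUpTo y k ≡ applyUpTo x n) (length-applyUpTo x n)

  applyUpTo-≡ : ∀ {x y : ℕ → A} {n} → applyUpTo y n ≡ applyUpTo x n → ∀ {i} → i ℕ.< n → y i ≡ x i
  applyUpTo-≡ {n = suc n} eq {zero}  _           = proj₁ (∷-injective eq)
  applyUpTo-≡ {n = suc n} eq {suc i} (ℕ.s≤s i<n) = applyUpTo-≡ (proj₂ (∷-injective eq)) i<n

  I-∷ʳ⁺ : ∀ {x : ℕ → A} σ → x ∈ I σ → x ∈ I (σ ∷ʳ x (length σ))
  I-∷ʳ⁺ {x} σ x∈ = trans (cong (applyUpTo x) (∷ʳ-length σ _))
    (trans (sym (applyUpTo-∷ʳ x (length σ))) (cong (_∷ʳ x (length σ)) x∈))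

  I-∷ʳ⁻ : ∀ {x : ℕ → A} σ {b} → x ∈ I (σ ∷ʳ b) → x ∈ I σ
  I-∷ʳ⁻ {x} σ {b} x∈ = ∷ʳ-injectiveˡ _ σ (trans (applyUpTo-∷ʳ x (length σ))
    (trans (cong (applyUpTo x) (sym (∷ʳ-length σ b))) x∈))

  prepend : List A → (ℕ → A) → ℕ → A
  prepend []      x n       = x n
  prepend (a ∷ σ) x zero    = a
  prepend (a ∷ σ) x (suc n) = prepend σ x n

  applyUpTo-prepend : ∀ σ x n → applyUpTo (prepend σ x) (length σ ℕ.+ n) ≡ σ ++ applyUpTo x n
  applyUpTo-prepend []      x n = refl
  applyUpTo-prepend (a ∷ σ) x n = cong (a ∷_) (applyUpTo-prepend σ x n)

  prepend-∈I : ∀ σ x → prepend σ x ∈ I σ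
  prepend-∈I σ x = subst₂ (λ k τ → applyUpTo (prepend σ x) k ≡ τ)
    (ℕₚ.+-identityʳ (length σ)) (++-identityʳ σ) (applyUpTo-prepend σ x 0)

  -- The existential in the step is a Σ-type, so its witnesses can be iterated directly, without a
  -- choice principle.
  branch : {P : Pred (List A) 0ℓ} → (∀ σ → P σ → ∃[ a ] P (σ ∷ʳ a)) → P [] →
    ∃[ x ] ∀ n → P (applyUpTo x n)
  branch {P} step P[] = label , λ n → subst P (sym (path≡ n)) (proj₂ (path n))
    where
    path : ℕ → Σ (List A) P
    path zero    = [] , P[]
    path (suc n) = let (σ , p) = path n ; (a , q) = step σ p in σ ∷ʳ a , q

    label : ℕ → A
    label n = let (σ , p) = path n in proj₁ (step σ p)

    path≡ : ∀ n → applyUpTo label n ≡ proj₁ (path n)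
    path≡ zero    = refl
    path≡ (suc n) = trans (sym (applyUpTo-∷ʳ label n)) (cong (_∷ʳ label n) (path≡ n))

  -- `branch` is run on the continuations of `σ`; it yields `P` for all prefixes of length at least
  -- that of `σ`, and pruning carries it down to the shorter ones.
  branch-through : {P : Pred (List A) 0ℓ} → (∀ σ → P σ → ∃[ a ] P (σ ∷ʳ a)) →
    (∀ σ {a} → P (σ ∷ʳ a) → P σ) → ∀ σ → P σ → ∃[ x ] x ∈ I σ × (∀ n → P (applyUpTo x n))
  branch-through {P} step prune σ p = prepend σ x , prepend-∈I σ x , λ n →
    truncate (ℕₚ.≤⇒≤′ (ℕₚ.m≤n+m n (length σ))) (subst P (sym (applyUpTo-prepend σ x n)) (along n))
    where
    extension = branch {λ τ → P (σ ++ τ)}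
      (λ τ q → let (a , r) = step (σ ++ τ) q in a , subst P (++-assoc σ τ (a ∷ [])) r)
      (subst P (sym (++-identityʳ σ)) p)
    x = proj₁ extension
    along = proj₂ extension
    z = prepend σ x

    truncate : ∀ {m n} → m ℕ.≤′ n → P (applyUpTo z n) → P (applyUpTo z m)
    truncate ℕ.≤′-refl           q = q
    truncate (ℕ.≤′-step {n} m≤n) q = truncate m≤n (prune _ (subst P (sym (applyUpTo-∷ʳ z n)) q))

lower-em : ExcludedMiddle 1ℓ → ExcludedMiddle 0ℓ
lower-em em {P} = map′ lower lift (em {Lift 1ℓ P})

module Compactness (em : ExcludedMiddle 0ℓ) where

  ¬∀⇒∃¬ : {P : ℕ → Set} → ¬ (∀ n → P n) → ∃[ n ] ¬ P n
  ¬∀⇒∃¬ ¬all = decidable-stable em λ none → ¬all λ n → decidable-stable em λ ¬p → none (n , ¬p)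

  ∈-closed : ∀ {A : Set} {C : Pred (ℕ → A) 0ℓ} → IsClosed C →
    ∀ x → (∀ n → C ≬ I (applyUpTo x n)) → x ∈ C
  ∈-closed closed x meets = decidable-stable em λ x∉C →
    let (n , I⊆∁C) = closed x x∉C ; (y , y∈C , y∈I) = meets n in I⊆∁C y∈I y∈C

  -- König's argument: follow strings whose interval meets every `C n`. The path obtained is
  -- adherent to each `C n`, hence belongs to it.
  compact : (C : ℕ → Pred 2^ℕ 0ℓ) → (∀ n → IsClosed (C n)) → (∀ n → C (suc n) ⊆ C n) →
    (∀ n → Satisfiable (C n)) → Satisfiable (⋂ ℕ C)
  compact C closed dec sat = x , λ n → ∈-closed (closed n) x λ k → x-meets k n
    where
    Meets : Pred (List Bool) 0ℓ
    Meets σ = ∀ n → C n ≬ I σ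

    step : ∀ σ → Meets σ → ∃[ b ] Meets (σ ∷ʳ b)
    step σ meets = by-cases em
      where
      by-cases : Dec (Meets (σ ∷ʳ false)) → ∃[ b ] Meets (σ ∷ʳ b)
      by-cases (yes meets₀) = false , meets₀
      -- If some `C n` missed the right half, then for each `m` the point of `C (m ⊔ n)` in `I σ`
      -- would lie in the left half and in `C m`, contrary to `¬meets₀`.
      by-cases (no ¬meets₀) = true , λ n → decidable-stable em λ ¬C≬ → ¬meets₀ λ m → left n m ¬C≬
        where
        left : ∀ n m → ¬ (C n ≬ I (σ ∷ʳ true)) → C m ≬ I (σ ∷ʳ false)
        left n m ¬C≬ with meets (m ℕ.⊔ n)
        ... | z , z∈C , z∈I with z (length σ) | I-∷ʳ⁺ σ z∈I
        ...   | false | z∈I₀ = z , antitone C dec (ℕₚ.m≤m⊔n m n) z∈C , z∈I₀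
        ...   | true  | z∈I₁ = ⊥-elim (¬C≬ (z , antitone C dec (ℕₚ.m≤n⊔m m n) z∈C , z∈I₁))

    limit = branch {P = Meets} step (λ n → let (z , z∈C) = sat n in z , z∈C , refl)
    x = proj₁ limit
    x-meets = proj₂ limit

≺-trans : ∀ {σ τ υ} → σ ≺ τ → τ ≺ υ → σ ≺ υ
≺-trans (inj₁ p)       (inj₁ q)       = inj₁ (ℕₚ.<-trans p q)
≺-trans (inj₁ p)       (inj₂ (e , _)) = inj₁ (subst (_ ℕ.<_) e p)
≺-trans (inj₂ (e , _)) (inj₁ q)       = inj₁ (subst (ℕ._< _) (sym e) q)
≺-trans (inj₂ (d , p)) (inj₂ (e , q)) =
  inj₂ (trans d e , <-transitive isEquivalence Boolₚ.<-resp₂-≡ Boolₚ.<-trans p q)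

≺-irrefl : ∀ {σ} → ¬ (σ ≺ σ)
≺-irrefl (inj₁ p)       = ℕₚ.<-irrefl refl p
≺-irrefl (inj₂ (_ , p)) = <-irreflexive Boolₚ.<-irrefl (Pointwise.refl refl) p

≺-∷ʳ : ∀ σ b → σ ≺ (σ ∷ʳ b)
≺-∷ʳ σ b = inj₁ (ℕₚ.≤-reflexive (sym (∷ʳ-length σ b)))

-- This is why breadth-first search respects the order: children inherit the order of their parents.
-- In the lexicographic case equal lengths matter, since they exclude that `σ` is a proper prefix of
-- `τ`, where `b` would be compared with an entry of `τ`.
∷ʳ-mono-≺ : ∀ {σ τ} b c → σ ≺ τ → (σ ∷ʳ b) ≺ (τ ∷ʳ c)
∷ʳ-mono-≺ {σ} {τ} b c (inj₁ p) =
  inj₁ (subst₂ ℕ._<_ (sym (∷ʳ-length σ b)) (sym (∷ʳ-length τ c)) (ℕ.s≤s p))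
∷ʳ-mono-≺ {σ} {τ} b c (inj₂ (e , p)) =
  inj₂ (trans (∷ʳ-length σ b) (trans (cong suc e) (sym (∷ʳ-length τ c))) , lex e p)
  where
  lex : ∀ {σ τ} → length σ ≡ length τ → Lex-< _≡_ Bool._<_ σ τ → Lex-< _≡_ Bool._<_ (σ ∷ʳ b) (τ ∷ʳ c)
  lex e (base ())
  lex () halt
  lex e (this p)      = this p
  lex e (next refl p) = next refl (lex (ℕₚ.suc-injective e) p)

∷ʳ-false≺∷ʳ-true : ∀ σ → (σ ∷ʳ false) ≺ (σ ∷ʳ true)
∷ʳ-false≺∷ʳ-true σ = inj₂ (trans (∷ʳ-length σ false) (sym (∷ʳ-length σ true)) , lex σ)
  where
  lex : ∀ σ → Lex-< _≡_ Bool._<_ (σ ∷ʳ false) (σ ∷ʳ true)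
  lex []      = this Bool.f<t
  lex (b ∷ σ) = next refl (lex σ)

module _ (K : 𝒞) where

  []∈T : [] ∈ T[ K ]
  []∈T = let (z , z∈K) = nonempty K in z , z∈K , refl

  T-prune : ∀ σ {b} → σ ∷ʳ b ∈ T[ K ] → σ ∈ T[ K ]
  T-prune σ (z , z∈K , z∈I) = z , z∈K , I-∷ʳ⁻ σ z∈I

  T-infinite : ∀ n → ∃[ σ ] length σ ≡ n × σ ∈ T[ K ]
  T-infinite n = let (z , z∈K) = nonempty K in
    applyUpTo z n , length-applyUpTo z n , z , z∈K , applyUpTo-∈I z n

module Increasing {s : ℕ → List Bool} {T : Pred (List Bool) 0ℓ} (enum : Enumerates s T) where
  open Enumerates enum

  reflects-< : ∀ {m n} → s m ≺ s n → m ℕ.< n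
  reflects-< {m} {n} p with ℕₚ.<-cmp m n
  ... | tri< m<n _ _  = m<n
  ... | tri≈ _ refl _ = ⊥-elim (≺-irrefl p)
  ... | tri> _ _ n<m  = ⊥-elim (≺-irrefl (≺-trans p (increasing n m n<m)))

  injective : ∀ {m n} → s m ≡ s n → m ≡ n
  injective {m} {n} eq with ℕₚ.<-cmp m n
  ... | tri< m<n _ _ = ⊥-elim (≺-irrefl (subst (_≺ s n) eq (increasing m n m<n)))
  ... | tri≈ _ m≡n _ = m≡n
  ... | tri> _ _ n<m = ⊥-elim (≺-irrefl (subst (s n ≺_) eq (increasing n m n<m)))

Symbol-child : ∀ {T T′ σ a} → Symbol T σ a → Symbol T′ σ a → ∀ {b} → σ ∷ʳ b ∈ T → σ ∷ʳ b ∈ T′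
Symbol-child (only-0 _ _) (only-0 p _) {false} _ = p
Symbol-child (only-0 _ q) (only-0 _ _) {true}  r = ⊥-elim (q r)
Symbol-child (only-1 q _) (only-1 _ _) {false} r = ⊥-elim (q r)
Symbol-child (only-1 _ _) (only-1 _ p) {true}  _ = p
Symbol-child (both _ _)   (both p _)   {false} _ = p
Symbol-child (both _ _)   (both _ p)   {true}  _ = p

module _ {K K′ : 𝒞} {x x′ : 3^ℕ} (c : IsCode K x) (c′ : IsCode K′ x′) where

  private
    s s′ : ℕ → List Bool
    s  = proj₁ c
    s′ = proj₁ c′

    enum′ : Enumerates s′ T[ K′ ]
    enum′ = proj₁ (proj₂ c′)

    module E  = Enumerates (proj₁ (proj₂ c))
    module E′ = Enumerates enum′

  -- The parent of s′ m comes earlier in the second enumeration, hence in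
  -- the first one, and there it has the same children.
  node-transfer : ∀ m → (∀ i → i ℕ.< m → s i ≡ s′ i) → (∀ i → i ℕ.< m → x i ≡ x′ i) → s′ m ∈ T[ K ]
  node-transfer m same agree with s′ m in eq
  ... | τ with initLast τ
  ...   | []      = []∈T K
  ...   | ρ ∷ʳ′ b with E′.complete ρ (T-prune K′ ρ (subst (_∈ T[ K′ ]) eq (E′.sound m)))
  ...     | i , refl = Symbol-child (proj₂ (proj₂ c′) i)
    (subst₂ (Symbol T[ K ]) (same i i<m) (agree i i<m) (proj₂ (proj₂ c) i))
    (subst (_∈ T[ K′ ]) eq (E′.sound m))
    where
    i<m : i ℕ.< m
    i<m = Increasing.reflects-< enum′ (subst (s′ i ≺_) (sym eq) (≺-∷ʳ (s′ i) b))

  -- `s′ m` occurs in the first enumeration, at some index `j`. If `j` were below `m`, then `s j`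
  -- would be `s′ j`, and `s′` would repeat a value.
  not-later : ∀ m → (∀ i → i ℕ.< m → s i ≡ s′ i) → (∀ i → i ℕ.< m → x i ≡ x′ i) → s m ≡ s′ m ⊎ s m ≺ s′ m
  not-later m same agree with E.complete (s′ m) (node-transfer m same agree)
  ... | j , sj≡s′m with ℕₚ.<-cmp m j
  ...   | tri< m<j _ _  = inj₂ (subst (s m ≺_) sj≡s′m (E.increasing m j m<j))
  ...   | tri≈ _ refl _ = inj₁ sj≡s′m
  ...   | tri> _ _ j<m  = ⊥-elim (ℕₚ.<-irrefl
    (Increasing.injective enum′ (trans (sym (same j j<m)) sj≡s′m)) j<m)

-- Strong induction, with `not-later` used in both directions and asymmetry of `≺`. The bound
-- includes `m ≡ n`: a node is fixed by the symbols of strictly earlier nodes.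
enumerations-agree : ∀ {K K′ x x′} (c : IsCode K x) (c′ : IsCode K′ x′) n →
  (∀ i → i ℕ.< n → x i ≡ x′ i) → ∀ m → m ℕ.≤ n → proj₁ c m ≡ proj₁ c′ m
enumerations-agree {K} {K′} c c′ n agree = <-rec (λ m → m ℕ.≤ n → proj₁ c m ≡ proj₁ c′ m)
  λ m same m≤n →
  let same′ = λ i i<m → same {i} i<m (ℕₚ.≤-trans (ℕₚ.<⇒≤ i<m) m≤n)
      agree′ = λ i i<m → agree i (ℕₚ.<-≤-trans i<m m≤n)
  in neither-earlier (not-later {K} {K′} c c′ m same′ agree′)
                     (not-later {K′} {K} c′ c m (λ i p → sym (same′ i p)) (λ i p → sym (agree′ i p)))
  where
  neither-earlier : ∀ {σ τ} → σ ≡ τ ⊎ σ ≺ τ → τ ≡ σ ⊎ τ ≺ σ → σ ≡ τ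
  neither-earlier (inj₁ p) _        = p
  neither-earlier (inj₂ _) (inj₁ q) = sym q
  neither-earlier (inj₂ p) (inj₂ q) = ⊥-elim (≺-irrefl (≺-trans p q))

-- `N` is the index of some string of length `n + 1` in the tree of `K`. The other enumeration has
-- the same string at `N`, so every string of length at most `n` in the tree of `K′` is listed
-- before it, where the two enumerations coincide.
code-local : ∀ {K x} → IsCode K x → ∀ n → ∃[ N ] (∀ {K′ x′} → IsCode K′ x′ →
  (∀ i → i ℕ.< N → x i ≡ x′ i) → ∀ σ → length σ ℕ.≤ n → σ ∈ T[ K′ ] → σ ∈ T[ K ])
code-local {K} c@(s , enum , _) n with T-infinite K (suc n)
... | τ , length≡ , τ∈T with Enumerates.complete enum τ τ∈T
...   | N , refl = N , λ {K′} c′@(s′ , enum′ , _) agree σ length≤ σ∈T′ →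
  let same = enumerations-agree {K} {K′} c c′ N agree
      (j , s′j≡σ) = Enumerates.complete enum′ σ σ∈T′
      σ≺s′N = subst (σ ≺_) (same N ℕₚ.≤-refl)
                (inj₁ (subst (length σ ℕ.<_) (sym length≡) (ℕ.s≤s length≤)))
      j<N = Increasing.reflects-< enum′ (subst (_≺ s′ N) (sym s′j≡σ) σ≺s′N)
  in subst (_∈ T[ K ]) (trans (same j (ℕₚ.<⇒≤ j<N)) s′j≡σ) (Enumerates.sound enum j)

-- Equal codes agree on any number of symbols, so `code-local` puts every prefix of `z` into the
-- tree of `K`, and closedness puts `z` into `K`.
code-injective : ExcludedMiddle 0ℓ → ∀ {K K′ x} → IsCode K x → IsCode K′ x → carrier K′ ⊆ carrier K
code-injective em {K} {K′} c c′ {z} z∈K′ = Compactness.∈-closed em (closed K) z λ n →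
  let (_ , local) = code-local {K} c n in
  local {K′} c′ (λ _ _ → refl) (applyUpTo z n) (ℕₚ.≤-reflexive (length-applyUpTo z n))
    (z , z∈K′ , applyUpTo-∈I z n)

-- Surjectivity of the coding

-- Head and tail are kept apart because every symbol leaves at least one child. Hence the queue is
-- never exhausted and the decoded tree has no dead ends.
children : List Bool → Fin 3 → List Bool × List (List Bool)
children σ zero             = σ ∷ʳ false , []
children σ (suc zero)       = σ ∷ʳ true , []
children σ (suc (suc zero)) = σ ∷ʳ false , (σ ∷ʳ true) ∷ []

entries : List Bool × List (List Bool) → List (List Bool)
entries (σ , σs) = σ ∷ σs

advance : List Bool × List (List Bool) → Fin 3 → List Bool × List (List Bool)
advance (σ , [])     a = children σ a
advance (σ , τ ∷ τs) a = τ , τs ++ entries (children σ a)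

entries-advance : ∀ q a → entries (advance q a) ≡ proj₂ q ++ entries (children (proj₁ q) a)
entries-advance (σ , [])    a = refl
entries-advance (σ , _ ∷ _) a = refl

All-children : ∀ {P : Pred (List Bool) 0ℓ} {σ} → (∀ b → P (σ ∷ʳ b)) → ∀ a → All P (entries (children σ a))
All-children p zero             = p false ∷ []
All-children p (suc zero)       = p true ∷ []
All-children p (suc (suc zero)) = p false ∷ p true ∷ []

children-head : ∀ σ a → ∃[ b ] proj₁ (children σ a) ≡ σ ∷ʳ b
children-head σ zero             = false , refl
children-head σ (suc zero)       = true , refl
children-head σ (suc (suc zero)) = false , refl

∈-children : ∀ σ {τ} a → τ List∈.∈ entries (children σ a) → ∃[ b ] τ ≡ σ ∷ʳ b
∈-children σ a τ∈ = All.lookup (All-children {λ τ → ∃[ b ] τ ≡ σ ∷ʳ b} (λ b → b , refl) a) τ∈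

children-sorted : ∀ σ a → AllPairs _≺_ (entries (children σ a))
children-sorted σ zero             = [] ∷ []
children-sorted σ (suc zero)       = [] ∷ []
children-sorted σ (suc (suc zero)) = (∷ʳ-false≺∷ʳ-true σ ∷ []) ∷ [] ∷ []

symbol : ∀ {T : Pred (List Bool) 0ℓ} σ a → (∀ {τ} → τ List∈.∈ entries (children σ a) → τ ∈ T) →
  (∀ b → σ ∷ʳ b ∈ T → σ ∷ʳ b List∈.∈ entries (children σ a)) → Symbol T σ a
symbol σ zero all⊆ ⊆all = only-0 (all⊆ (here refl)) λ p → case (⊆all true p)
  where
  case : ¬ σ ∷ʳ true List∈.∈ (σ ∷ʳ false) ∷ []
  case (here eq) with () ← ∷ʳ-injectiveʳ σ σ eq
symbol σ (suc zero) all⊆ ⊆all = only-1 (λ p → case (⊆all false p)) (all⊆ (here refl))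
  where
  case : ¬ σ ∷ʳ false List∈.∈ (σ ∷ʳ true) ∷ []
  case (here eq) with () ← ∷ʳ-injectiveʳ σ σ eq
symbol σ (suc (suc zero)) all⊆ ⊆all = both (all⊆ (here refl)) (all⊆ (there (here refl)))

-- Breadth-first search through the tree coded by x, with a nonempty queue
-- of nodes to be visited.
module Decode (x : 3^ℕ) where

  queue : ℕ → List Bool × List (List Bool)
  queue zero    = [] , []
  queue (suc n) = advance (queue n) (x n)

  node : ℕ → List Bool
  node n = proj₁ (queue n)

  Tree : Pred (List Bool) 0ℓ
  Tree σ = ∃[ n ] node n ≡ σ

  entries-suc : ∀ n → entries (queue (suc n)) ≡ proj₂ (queue n) ++ entries (children (node n) (x n))
  entries-suc n = entries-advance (queue n) (x n)

  -- Recursion on the entries in front of `τ`: each step removes the first entry and adds new ones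
  -- only at the back.
  queued⇒visited : ∀ n {τ} → τ List∈.∈ entries (queue n) → τ ∈ Tree
  queued⇒visited n τ∈ = let (σs , τs , eq) = ∈-∃++ τ∈ in go σs n eq
    where
    go : ∀ σs n {τ τs} → entries (queue n) ≡ σs ++ τ ∷ τs → τ ∈ Tree
    go []       n eq = n , proj₁ (∷-injective eq)
    go (σ ∷ σs) n {τ} {τs} eq = go σs (suc n) (trans (entries-suc n)
      (trans (cong (_++ entries (children (node n) (x n))) (proj₂ (∷-injective eq)))
             (++-assoc σs (τ ∷ τs) _)))

  child⇒visited : ∀ n {τ} → τ List∈.∈ entries (children (node n) (x n)) → τ ∈ Tree
  child⇒visited n τ∈ = queued⇒visited (suc n)
    (subst (_ List∈.∈_) (sym (entries-suc n)) (∈-++⁺ʳ (proj₂ (queue n)) τ∈))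

  queued-origin : ∀ n {τ} → τ List∈.∈ entries (queue n) →
    τ ≡ [] ⊎ ∃[ i ] τ List∈.∈ entries (children (node i) (x i))
  queued-origin zero    (here eq) = inj₁ eq
  queued-origin (suc n) τ∈
    with ∈-++⁻ (proj₂ (queue n)) (subst (_ List∈.∈_) (entries-suc n) τ∈)
  ... | inj₁ τ∈rest     = queued-origin n (there τ∈rest)
  ... | inj₂ τ∈children = inj₂ (n , τ∈children)

  visited-origin : ∀ σ {b} → σ ∷ʳ b ∈ Tree →
    ∃[ i ] node i ≡ σ × σ ∷ʳ b List∈.∈ entries (children (node i) (x i))
  visited-origin σ (n , eq) with queued-origin n (here (sym eq))
  ... | inj₁ σb≡[] with () ← trans (sym (∷ʳ-length σ _)) (cong length σb≡[])
  ... | inj₂ (i , σb∈) = i , sym (∷ʳ-injectiveˡ σ _ (proj₂ (∈-children (node i) (x i) σb∈))) , σb∈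

  Tree-prune : ∀ σ {b} → σ ∷ʳ b ∈ Tree → σ ∈ Tree
  Tree-prune σ σb∈ = let (i , eq , _) = visited-origin σ σb∈ in i , eq

  Tree-step : ∀ σ → σ ∈ Tree → ∃[ b ] σ ∷ʳ b ∈ Tree
  Tree-step σ (n , refl) = let (b , eq) = children-head σ (x n) in
    b , subst Tree eq (child⇒visited n (here refl))

  -- The second invariant maintains the first: new children go to the back, so everything already
  -- queued must precede them. It survives a step because the next head is later, and so is its left
  -- child.
  queue-sorted : ∀ n → AllPairs _≺_ (entries (queue n)) × All (_≺ (node n ∷ʳ false)) (entries (queue n))
  queue-sorted zero    = [] ∷ [] , ≺-∷ʳ [] false ∷ []
  queue-sorted (suc n) with queue n | queue-sorted n
  ... | σ , [] | _ = let (b , eq) = children-head σ (x n) in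
    children-sorted σ (x n) ,
    -- The new queue consists of children of `σ`, which are one longer than `σ`; the left child of
    -- its head is two longer.
    All-children (λ c → inj₁ (subst₂ ℕ._<_ (sym (∷ʳ-length σ c))
      (sym (trans (cong (length ∘ (_∷ʳ false)) eq)
        (trans (∷ʳ-length (σ ∷ʳ b) false) (cong suc (∷ʳ-length σ b)))))
      ℕₚ.≤-refl)) (x n)
  ... | σ , τ ∷ τs | (σ≺τ ∷ _) ∷ sorted , _ ∷ below =
    AllPairsₚ.++⁺ sorted (children-sorted σ (x n)) (All.map (λ p → All-children (later p) (x n)) below) ,
    Allₚ.++⁺ (All.map (λ p → ≺-trans p (∷ʳ-mono-≺ false false σ≺τ)) below)
      (All-children (λ b → ∷ʳ-mono-≺ b false σ≺τ) (x n))
    where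
    later : ∀ {υ} → υ ≺ (σ ∷ʳ false) → ∀ b → υ ≺ (σ ∷ʳ b)
    later p false = p
    later p true  = ≺-trans p (∷ʳ-false≺∷ʳ-true σ)

  node-≺-suc : ∀ n → node n ≺ node (suc n)
  node-≺-suc n with queue n | queue-sorted n
  ... | σ , []     | _ = let (b , eq) = children-head σ (x n) in subst (σ ≺_) (sym eq) (≺-∷ʳ σ b)
  ... | σ , τ ∷ τs | (σ≺τ ∷ _) ∷ _ , _ = σ≺τ

  node-increasing : ∀ m n → m ℕ.< n → node m ≺ node n
  node-increasing m n m<n = go (ℕₚ.≤⇒≤′ m<n)
    where
    go : ∀ {n} → suc m ℕ.≤′ n → node m ≺ node n
    go ℕ.≤′-refl         = node-≺-suc m
    go (ℕ.≤′-step {n} p) = ≺-trans (go p) (node-≺-suc n)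

  module _ (em : ExcludedMiddle 0ℓ) where

    decoded : 𝒞
    decoded = record
      { carrier  = λ z → ∀ n → applyUpTo z n ∈ Tree
      ; closed   = λ z z∉ → let (n , ∉Tree) = Compactness.¬∀⇒∃¬ em z∉ in
          n , λ {y} y∈I y∈ → ∉Tree (subst Tree (I-applyUpTo {x = z} {y} n y∈I) (y∈ n))
      ; nonempty = let (z , _ , z∈) = branch-through Tree-step Tree-prune [] (0 , refl) in z , z∈
      }

    T⊆Tree : T[ decoded ] ⊆ Tree
    T⊆Tree {σ} (z , z∈ , z∈I) = subst Tree z∈I (z∈ (length σ))

    Tree⊆T : Tree ⊆ T[ decoded ]
    Tree⊆T {σ} σ∈ = let (z , z∈I , z∈) = branch-through Tree-step Tree-prune σ σ∈ in z , z∈ , z∈I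

    enumerates : Enumerates node T[ decoded ]
    enumerates = record
      { sound      = λ n → Tree⊆T (n , refl)
      ; complete   = λ _ → T⊆Tree
      ; increasing = node-increasing
      }

    decoded-code : IsCode decoded x
    decoded-code = node , enumerates , λ n →
      symbol (node n) (x n) (λ τ∈ → Tree⊆T (child⇒visited n τ∈)) (allowed n)
      where
      allowed : ∀ n b → node n ∷ʳ b ∈ T[ decoded ] → node n ∷ʳ b List∈.∈ entries (children (node n) (x n))
      allowed n b p with visited-origin (node n) (T⊆Tree p)
      -- The origin of the child is a visit `i` to the same string; strings are visited only once,
      -- so it is visit `n`.
      ... | i , eq , b∈ with Increasing.injective enumerates {i} {n} eq
      ...   | refl = b∈

-- The event that the coded set meets a closed set

module Events (em : ExcludedMiddle 1ℓ) where
  private em₀ = lower-em em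
  open Compactness em₀

  Hits : Pred 2^ℕ 0ℓ → Pred 3^ℕ 1ℓ
  Hits Q = codes (λ K → carrier K ≬ Q)

  ∩-closed : ∀ {Q R : Pred 2^ℕ 0ℓ} → IsClosed Q → IsClosed R → IsClosed (Q ∩ R)
  ∩-closed {Q} {R} cQ cR x x∉ = by-cases em₀
    where
    by-cases : Dec (x ∈ Q) → ∃[ n ] (I (applyUpTo x n) ⊆ ∁ (Q ∩ R))
    by-cases (yes x∈Q) = let (n , I⊆) = cR x (λ x∈R → x∉ (x∈Q , x∈R)) in n , λ y∈I (_ , y∈R) → I⊆ y∈I y∈R
    by-cases (no  x∉Q) = let (n , I⊆) = cQ x x∉Q in n , λ y∈I (y∈Q , _) → I⊆ y∈I y∈Q

  ⋂-closed : ∀ {J : Set} {Q : J → Pred 2^ℕ 0ℓ} → (∀ j → IsClosed (Q j)) → IsClosed (⋂ J Q)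
  ⋂-closed {J} {Q} cQ x x∉ =
    let (j , x∉Q) = decidable-stable em₀ λ none → x∉ λ j → decidable-stable em₀ λ x∉Q → none (j , x∉Q)
        (n , I⊆)  = cQ j x x∉Q
    in n , λ y∈I y∈ → I⊆ y∈I (y∈ j)

  compact-≬ : (K : 𝒞) (R : ℕ → Pred 2^ℕ 0ℓ) → (∀ n → IsClosed (R n)) → (∀ n → R (suc n) ⊆ R n) →
    (∀ n → carrier K ≬ R n) → carrier K ≬ ⋂ ℕ R
  compact-≬ K R cR dec meets =
    let (x , x∈) = compact (λ n → carrier K ∩ R n) (λ n → ∩-closed (closed K) (cR n))
                     (λ n (x∈K , x∈R) → x∈K , dec n x∈R) meets
    in x , proj₁ (x∈ 0) , proj₂ ∘ x∈

  -- Clopen neighbourhoods, decreasing in `n`, whose intersection is `Q` if `Q` is closed.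
  neighbourhood : Pred 2^ℕ 0ℓ → ℕ → Pred 2^ℕ 0ℓ
  neighbourhood Q n z = Q ≬ I (applyUpTo z n)

  neighbourhood-closed : ∀ Q n → IsClosed (neighbourhood Q n)
  neighbourhood-closed Q n z z∉ = n , λ {y} y∈I y∈ →
    z∉ (subst (λ σ → Q ≬ I σ) (I-applyUpTo {x = z} {y} n y∈I) y∈)

  neighbourhood-decreasing : ∀ Q n → neighbourhood Q (suc n) ⊆ neighbourhood Q n
  neighbourhood-decreasing Q n {z} (y , y∈Q , y∈I) = y , y∈Q , I-∷ʳ⁻ (applyUpTo z n)
    (subst (λ σ → y ∈ I σ) (sym (applyUpTo-∷ʳ z n)) y∈I)

  -- Let `x` code a set `K` that misses `Q`. By compactness `K` misses some `neighbourhood Q n`; let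
  -- `N` be the number of symbols from `code-local`. If a code agreeing with `x` below `N` had a set
  -- meeting `Q` in `z`, the prefix of `z` of length `n` would lie in the tree of `K`, and `K` would
  -- meet that neighbourhood.
  Hits-closed : ∀ {Q} → IsClosed Q → IsClosed (Hits Q)
  Hits-closed {Q} cQ x x∉ = N , λ {x′} x′∈I (K′ , (z , z∈K′ , z∈Q) , code′) →
    let (y , y∈K , y∈I) = local {K′} code′
          (λ i i<N → sym (applyUpTo-≡ (I-applyUpTo {x = x} {x′} N x′∈I) i<N))
          (applyUpTo z n) (ℕₚ.≤-reflexive (length-applyUpTo z n)) (z , z∈K′ , applyUpTo-∈I z n)
    in separated (y , y∈K , z , z∈Q , applyUpTo-∈I-sym n (I-applyUpTo {x = z} {y} n y∈I))
    where
    K = Decode.decoded x em₀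
    code : IsCode K x
    code = Decode.decoded-code x em₀

    applyUpTo-∈I-sym : ∀ n {y z : 2^ℕ} → applyUpTo y n ≡ applyUpTo z n → z ∈ I (applyUpTo y n)
    applyUpTo-∈I-sym n {y} {z} eq = subst (λ σ → z ∈ I σ) (sym eq) (applyUpTo-∈I z n)

    separation : ∃[ n ] ¬ (carrier K ≬ neighbourhood Q n)
    separation = ¬∀⇒∃¬ λ meets → x∉
      (K , (let (z , z∈K , z∈) = compact-≬ K (neighbourhood Q) (neighbourhood-closed Q)
                  (neighbourhood-decreasing Q) meets
            in z , z∈K , ∈-closed cQ z z∈) , code)
    n = proj₁ separation
    separated = proj₂ separation
    N = proj₁ (code-local {K} code n)
    local = proj₂ (code-local {K} code n)

  Hits-borel : ∀ {Q} → IsClosed Q → IsBorel (Hits Q)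
  Hits-borel cQ = respects-≐ ((λ x∉∁ → decidable-stable em x∉∁) , λ x∈ x∉ → x∉ x∈)
    (complement (open-set (Hits-closed cQ)))

-- Listing the trees that contain a string

BoolTree : Set
BoolTree = List (List Bool)

-- An empty list stands for an absent subtree. Trees with dead ends below the full height therefore
-- also arise; no nonempty closed set has such a truncation, so they contribute the empty family.
graft : BoolTree → BoolTree → BoolTree
graft L R = [] ∷ List.map (false ∷_) L ++ List.map (true ∷_) R

-- trees σ lists the trees contained in {0,1}^{≤ |σ|}, and those of them
-- that contain σ.
treesStep : Bool → List BoolTree × List BoolTree → List BoolTree × List BoolTree
treesStep b (all , through) = [] ∷ cartesianProductWith graft all all ,
  (if b then cartesianProductWith graft all through else cartesianProductWith graft through all)

trees : List Bool → List BoolTree × List BoolTree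
trees []      = [] ∷ ([] ∷ []) ∷ [] , ([] ∷ []) ∷ []
trees (b ∷ σ) = treesStep b (trees σ)

treesThrough : List Bool → List BoolTree
treesThrough σ = proj₂ (trees σ)

-- Each string is treated at the height given by its own length. The resulting families may overlap,
-- which is harmless because only their union is measured.
hittingTrees : List (List Bool) → List (ℕ × BoolTree)
hittingTrees = concatMap λ σ → List.map (length σ ,_) (treesThrough σ)

∈-hittingTrees⁺ : ∀ {σs σ A} → σ List∈.∈ σs → A List∈.∈ treesThrough σ →
  (length σ , A) List∈.∈ hittingTrees σs
∈-hittingTrees⁺ σ∈ A∈ = ∈-concatMap⁺ _ (lose σ∈ (∈-map⁺ _ A∈))

∈-hittingTrees⁻ : ∀ σs {nA} → nA List∈.∈ hittingTrees σs →
  ∃[ σ ] ∃[ A ] σ List∈.∈ σs × A List∈.∈ treesThrough σ × nA ≡ (length σ , A)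
∈-hittingTrees⁻ σs nA∈ =
  let (σ , σ∈ , nA∈′) = find (∈-concatMap⁻ _ {xs = σs} nA∈) ; (A , A∈ , eq) = ∈-map⁻ _ nA∈′
  in σ , A , σ∈ , A∈ , eq

∈-graft⁻ : ∀ L R {b τ} → b ∷ τ List∈.∈ graft L R → τ List∈.∈ (if b then R else L)
∈-graft⁻ L R (there τ∈) with ∈-++⁻ (List.map (false ∷_) L) τ∈
... | inj₁ p with _ , q , refl ← ∈-map⁻ (false ∷_) p = q
... | inj₂ p with _ , q , refl ← ∈-map⁻ (true ∷_) p = q

∈-graft⁺ : ∀ L R b {τ} → τ List∈.∈ (if b then R else L) → b ∷ τ List∈.∈ graft L R
∈-graft⁺ L R false τ∈ = there (∈-++⁺ˡ (∈-map⁺ (false ∷_) τ∈))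
∈-graft⁺ L R true  τ∈ = there (∈-++⁺ʳ (List.map (false ∷_) L) (∈-map⁺ (true ∷_) τ∈))

graft-isTree : ∀ {n L R} → IsTree (n , L) → IsTree (n , R) → IsTree (suc n , graft L R)
graft-isTree {n} {L} {R} (L≤ , L-prune) (R≤ , R-prune) = bounded , prune
  where
  bounded : ∀ σ → σ List∈.∈ graft L R → length σ ℕ.≤ suc n
  bounded []          _  = ℕ.z≤n
  bounded (false ∷ σ) σ∈ = ℕ.s≤s (L≤ σ (∈-graft⁻ L R σ∈))
  bounded (true ∷ σ)  σ∈ = ℕ.s≤s (R≤ σ (∈-graft⁻ L R σ∈))

  prune : ∀ σ τ → σ ++ τ List∈.∈ graft L R → σ List∈.∈ graft L R
  prune []          τ _ = here refl
  prune (false ∷ σ) τ p = ∈-graft⁺ L R false (L-prune σ τ (∈-graft⁻ L R p))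
  prune (true ∷ σ)  τ p = ∈-graft⁺ L R true (R-prune σ τ (∈-graft⁻ L R p))

[]-isTree : ∀ {n} → IsTree (n , [])
[]-isTree = (λ _ ()) , λ _ _ ()

[[]]-isTree : IsTree (0 , [] ∷ [])
[[]]-isTree = (λ { _ (here refl) → ℕ.z≤n }) ,
  λ { [] _ _ → here refl ; (_ ∷ _) _ (here ()) ; (_ ∷ _) _ (there ()) }

trees-isTree : ∀ σ → (∀ {A} → A List∈.∈ proj₁ (trees σ) → IsTree (length σ , A)) ×
                     (∀ {A} → A List∈.∈ treesThrough σ → IsTree (length σ , A))
trees-isTree [] =
  (λ { (here refl) → []-isTree ; (there (here refl)) → [[]]-isTree }) , λ { (here refl) → [[]]-isTree }
trees-isTree (b ∷ σ) =
    (λ { (here refl) → []-isTree ; (there A∈) → product (proj₁ ih) (proj₁ ih) A∈ })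
  , through b
  where
  ih = trees-isTree σ

  product : ∀ {n Ls Rs} → (∀ {A} → A List∈.∈ Ls → IsTree (n , A)) → (∀ {A} → A List∈.∈ Rs → IsTree (n , A)) →
    ∀ {A} → A List∈.∈ cartesianProductWith graft Ls Rs → IsTree (suc n , A)
  product {n} {Ls} {Rs} hL hR A∈ with ∈-cartesianProductWith⁻ graft Ls Rs A∈
  ... | L , R , L∈ , R∈ , refl = graft-isTree {n} {L} {R} (hL L∈) (hR R∈)

  through : ∀ b {A} → A List∈.∈ treesThrough (b ∷ σ) → IsTree (suc (length σ) , A)
  through false = product (proj₂ ih) (proj₁ ih)
  through true  = product (proj₁ ih) (proj₂ ih)

hittingTrees-isTree : ∀ σs → All IsTree (hittingTrees σs)
hittingTrees-isTree σs = All.tabulate λ nA∈ →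
  let (σ , A , _ , A∈ , eq) = ∈-hittingTrees⁻ σs nA∈ in subst IsTree (sym eq) (proj₂ (trees-isTree σ) A∈)

∈-treesThrough : ∀ σ {A} → A List∈.∈ treesThrough σ → σ List∈.∈ A
∈-treesThrough []      (here refl) = here refl
∈-treesThrough (false ∷ σ) A∈ with ∈-cartesianProductWith⁻ graft (treesThrough σ) (proj₁ (trees σ)) A∈
... | L , R , L∈ , _ , refl = ∈-graft⁺ L R false (∈-treesThrough σ L∈)
∈-treesThrough (true ∷ σ)  A∈ with ∈-cartesianProductWith⁻ graft (proj₁ (trees σ)) (treesThrough σ) A∈
... | L , R , _ , R∈ , refl = ∈-graft⁺ L R true (∈-treesThrough σ R∈)

Truncation : Pred (List Bool) 0ℓ → ℕ → BoolTree → Set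
Truncation P n A = (P ∩ (λ σ → length σ ℕ.≤ n)) ≐ (List∈._∈ A)

PrefixClosed : Pred (List Bool) 0ℓ → Set
PrefixClosed P = ∀ σ τ → P (σ ++ τ) → P σ

graft-truncation : ∀ {P n L R} → P [] → Truncation (P ∘ (false ∷_)) n L → Truncation (P ∘ (true ∷_)) n R →
  Truncation P (suc n) (graft L R)
graft-truncation {P} {n} {L} {R} p[] (to₀ , from₀) (to₁ , from₁) = to , from
  where
  to : ∀ {σ} → P σ × length σ ℕ.≤ suc n → σ List∈.∈ graft L R
  to {[]}        _              = here refl
  to {false ∷ σ} (p , ℕ.s≤s l≤) = ∈-graft⁺ L R false (to₀ (p , l≤))
  to {true ∷ σ}  (p , ℕ.s≤s l≤) = ∈-graft⁺ L R true (to₁ (p , l≤))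

  from : ∀ {σ} → σ List∈.∈ graft L R → P σ × length σ ℕ.≤ suc n
  from {[]}        _  = p[] , ℕ.z≤n
  from {false ∷ σ} σ∈ = let (p , l≤) = from₀ (∈-graft⁻ L R σ∈) in p , ℕ.s≤s l≤
  from {true ∷ σ}  σ∈ = let (p , l≤) = from₁ (∈-graft⁻ L R σ∈) in p , ℕ.s≤s l≤

[[]]-truncation : ∀ {P} → P [] → Truncation P 0 ([] ∷ [])
[[]]-truncation {P} p[] = to , λ { (here refl) → p[] , ℕ.z≤n }
  where
  to : ∀ {σ} → P σ × length σ ℕ.≤ 0 → σ List∈.∈ [] ∷ []
  to {[]}    _        = here refl
  to {_ ∷ _} (_ , ())

[]-truncation : ∀ {P n} → PrefixClosed P → ¬ P [] → Truncation P n []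
[]-truncation closed ¬p[] = (λ (p , _) → ⊥-elim (¬p[] (closed [] _ p))) , λ ()

module _ (em : ExcludedMiddle 0ℓ) where

  -- Stated for prefix-closed predicates instead of trees of closed sets: the induction passes to
  -- the part below one bit, which may be empty and is then truncated to `[]`.
  all-truncations : ∀ σ {P} → PrefixClosed P → ∃[ A ] A List∈.∈ proj₁ (trees σ) × Truncation P (length σ) A
  all-truncations σ {P} closed = by-cases σ em
    where
    by-cases : ∀ σ → Dec (P []) → ∃[ A ] A List∈.∈ proj₁ (trees σ) × Truncation P (length σ) A
    by-cases []      (no ¬p[]) = [] , here refl , []-truncation closed ¬p[]
    by-cases (_ ∷ _) (no ¬p[]) = [] , here refl , []-truncation closed ¬p[]
    by-cases []      (yes p[]) = [] ∷ [] , there (here refl) , [[]]-truncation p[]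
    by-cases (_ ∷ σ) (yes p[]) =
      let (L , L∈ , tL) = all-truncations σ (λ σ τ → closed (false ∷ σ) τ)
          (R , R∈ , tR) = all-truncations σ (λ σ τ → closed (true ∷ σ) τ)
      in graft L R , there (∈-cartesianProductWith⁺ graft L∈ R∈) , graft-truncation p[] tL tR

  through-truncations : ∀ σ {P} → PrefixClosed P → P σ →
    ∃[ A ] A List∈.∈ treesThrough σ × Truncation P (length σ) A
  through-truncations []          closed p = [] ∷ [] , here refl , [[]]-truncation p
  through-truncations (false ∷ σ) closed p =
    let (L , L∈ , tL) = through-truncations σ (λ σ τ → closed (false ∷ σ) τ) p
        (R , R∈ , tR) = all-truncations σ (λ σ τ → closed (true ∷ σ) τ)
    in graft L R , ∈-cartesianProductWith⁺ graft L∈ R∈ , graft-truncation (closed [] _ p) tL tR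
  through-truncations (true ∷ σ)  closed p =
    let (L , L∈ , tL) = all-truncations σ (λ σ τ → closed (false ∷ σ) τ)
        (R , R∈ , tR) = through-truncations σ (λ σ τ → closed (true ∷ σ) τ) p
    in graft L R , ∈-cartesianProductWith⁺ graft L∈ R∈ , graft-truncation (closed [] _ p) tL tR

I-++⁻ : ∀ {A : Set} (σ τ : List A) {x : ℕ → A} → x ∈ I (σ ++ τ) → x ∈ I σ
I-++⁻ []      τ x∈ = refl
I-++⁻ (a ∷ σ) τ x∈ = let (p , q) = ∷-injective x∈ in cong₂ _∷_ p (I-++⁻ σ τ q)

hits⇔hittingTree : ExcludedMiddle 0ℓ → ∀ σs →
  (λ K → carrier K ≬ (λ x → Any (λ σ → x ∈ I σ) σs)) ≐ (λ K → Any (λ A → K ∈ U[ A ]) (hittingTrees σs))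
hits⇔hittingTree em σs = (λ {K} → to {K}) , λ {K} → from {K}
  where
  to : ∀ {K} → carrier K ≬ (λ x → Any (λ σ → x ∈ I σ) σs) → Any (λ A → K ∈ U[ A ]) (hittingTrees σs)
  to {K} (x , x∈K , x∈) =
    let (σ , σ∈ , x∈I) = find x∈
        (A , A∈ , t) = through-truncations em σ {T[ K ]}
                         (λ σ τ (z , z∈K , z∈I) → z , z∈K , I-++⁻ σ τ z∈I) (x , x∈K , x∈I)
    in lose (∈-hittingTrees⁺ σ∈ A∈) t

  from : ∀ {K} → Any (λ A → K ∈ U[ A ]) (hittingTrees σs) → carrier K ≬ (λ x → Any (λ σ → x ∈ I σ) σs)
  from {K} any with find any
  ... | nA , nA∈ , K∈U with ∈-hittingTrees⁻ σs nA∈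
  ...   | σ , A , σ∈ , A∈ , refl =
    let ((x , x∈K , x∈I) , _) = proj₂ K∈U (∈-treesThrough σ A∈) in x , x∈K , lose σ∈ x∈I

-- Computability of the list of trees

snd² : ∀ {A B C} → Computable (A ⊗ B ⊗ C) C (λ x → proj₂ (proj₂ x))
snd² = comp snd snd

fst∘snd : ∀ {A B C} → Computable (A ⊗ B ⊗ C) B (λ x → proj₁ (proj₂ x))
fst∘snd = comp fst snd

snd³ : ∀ {A B C D} → Computable (A ⊗ B ⊗ C ⊗ D) D (λ x → proj₂ (proj₂ (proj₂ x)))
snd³ = comp snd snd²

swap-computable : ∀ {A B} → Computable (A ⊗ B) (B ⊗ A) (λ x → proj₂ x , proj₁ x)
swap-computable = pair snd fst

-- The recursion scheme `listrec` takes a parameter besides the list; for functions of the list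
-- alone, a copy of the input fills that place.
duplicate : ∀ {A} → Computable A (A ⊗ A) (λ x → x , x)
duplicate = pair id id

singleton : ∀ {A B f} → Computable A B f → Computable A (list B) (λ a → f a ∷ [])
singleton f = comp cons (pair f nil)

append : ∀ {A} → Computable (list A ⊗ list A) (list A) (λ x → proj₁ x ++ proj₂ x)
append = ext (λ (xs , ys) → correct xs ys)
  (comp (listrec id (comp cons (pair fst∘snd snd³))) swap-computable)
  where
  correct : ∀ {C : Set} (xs ys : List C) →
    recList (λ a → a) (λ x → proj₁ (proj₂ x) ∷ proj₂ (proj₂ (proj₂ x))) (ys , xs) ≡ xs ++ ys
  correct []       ys = refl
  correct (x ∷ xs) ys = cong (x ∷_) (correct xs ys)

map-computable : ∀ {A C D} {f : ⟦ A ⟧ × ⟦ C ⟧ → ⟦ D ⟧} → Computable (A ⊗ C) D f →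
  Computable (A ⊗ list C) (list D) (λ x → List.map (λ c → f (proj₁ x , c)) (proj₂ x))
map-computable {A} {C} {D} {f} cf = ext (λ (a , cs) → correct a cs)
  (listrec nil (comp cons (pair (comp cf (pair fst fst∘snd)) snd³)))
  where
  correct : ∀ a cs →
    recList (λ _ → []) (λ x → f (proj₁ x , proj₁ (proj₂ x)) ∷ proj₂ (proj₂ (proj₂ x))) (a , cs)
    ≡ List.map (λ c → f (a , c)) cs
  correct a []       = refl
  correct a (c ∷ cs) = cong (f (a , c) ∷_) (correct a cs)

concatMap-computable : ∀ {A C D} {f : ⟦ A ⟧ × ⟦ C ⟧ → List ⟦ D ⟧} → Computable (A ⊗ C) (list D) f →
  Computable (A ⊗ list C) (list D) (λ x → concatMap (λ c → f (proj₁ x , c)) (proj₂ x))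
concatMap-computable {A} {C} {D} {f} cf = ext (λ (a , cs) → correct a cs)
  (listrec nil (comp append (pair (comp cf (pair fst fst∘snd)) snd³)))
  where
  correct : ∀ a cs →
    recList (λ _ → []) (λ x → f (proj₁ x , proj₁ (proj₂ x)) ++ proj₂ (proj₂ (proj₂ x))) (a , cs)
    ≡ concatMap (λ c → f (a , c)) cs
  correct a []       = refl
  correct a (c ∷ cs) = cong (f (a , c) ++_) (correct a cs)

cartesianProductWith-computable : ∀ {A B C} {f : ⟦ A ⟧ → ⟦ B ⟧ → ⟦ C ⟧} →
  Computable (A ⊗ B) C (λ x → f (proj₁ x) (proj₂ x)) →
  Computable (list A ⊗ list B) (list C) (λ x → cartesianProductWith f (proj₁ x) (proj₂ x))
cartesianProductWith-computable {A} {B} {C} {f} cf = ext (λ (as , bs) → correct as bs)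
  (comp (concatMap-computable (comp (map-computable cf) swap-computable)) swap-computable)
  where
  correct : ∀ as bs → concatMap (λ a → List.map (f a) bs) as ≡ cartesianProductWith f as bs
  correct []       bs = refl
  correct (a ∷ as) bs = cong (List.map (f a) bs ++_) (correct as bs)

length-computable : ∀ {A} → Computable (list A) nat length
length-computable {A} = ext (λ as → correct as as)
  (comp (listrec {z = λ _ → 0} zero (comp suc snd³)) duplicate)
  where
  correct : ∀ (a as : List ⟦ A ⟧) →
    recList (λ _ → 0) (λ x → suc (proj₂ (proj₂ (proj₂ x)))) (a , as) ≡ length as
  correct a []       = refl
  correct a (_ ∷ as) = cong suc (correct a as)

str tree : Ty
str  = list bool
tree = list str

extend-computable : ∀ b → Computable tree tree (List.map (b ∷_))
extend-computable b = comp (map-computable (comp cons (pair (boolean b) snd))) duplicate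

graft-computable : Computable (tree ⊗ tree) tree (λ x → graft (proj₁ x) (proj₂ x))
graft-computable = comp cons (pair nil
  (comp append (pair (comp (extend-computable false) fst) (comp (extend-computable true) snd))))

treesStep-computable : Computable (bool ⊗ list tree ⊗ list tree) (list tree ⊗ list tree)
  (λ x → treesStep (proj₁ x) (proj₂ x))
treesStep-computable = pair
  (comp cons (pair nil (product fst∘snd fst∘snd)))
  (comp cond (pair fst (pair (product fst∘snd snd²) (product snd² fst∘snd))))
  where
  product : ∀ {A f g} → Computable A (list tree) f → Computable A (list tree) g →
    Computable A (list tree) (λ a → cartesianProductWith graft (f a) (g a))
  product cf cg = comp (cartesianProductWith-computable graft-computable) (pair cf cg)

trees-computable : Computable str (list tree ⊗ list tree) trees
trees-computable = ext (λ σ → correct σ σ)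
  (comp (listrec (pair (comp cons (pair nil (singleton (singleton nil)))) (singleton (singleton nil)))
                 (comp treesStep-computable (pair fst∘snd snd³)))
        duplicate)
  where
  correct : ∀ (ρ σ : List Bool) →
    recList (λ _ → trees []) (λ x → treesStep (proj₁ (proj₂ x)) (proj₂ (proj₂ (proj₂ x)))) (ρ , σ) ≡ trees σ
  correct ρ []      = refl
  correct ρ (b ∷ σ) = cong (treesStep b) (correct ρ σ)

hittingTrees-computable : Computable tree (list (nat ⊗ tree)) hittingTrees
hittingTrees-computable = comp
  (concatMap-computable {A = tree}
    (comp (map-computable (pair fst snd)) (comp (pair length-computable (comp snd trees-computable)) snd)))
  duplicate

-- The hitting capacity and its computability

module Capacity (em : ExcludedMiddle 1ℓ) {μ : Pred 3^ℕ 1ℓ → ℝ} (isProbability : IsBorelProbability μ) where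

  open Measure em isProbability
  open Events em
  open IsBorelProbability isProbability

  private em₀ = lower-em em

  U-closed : IsClosed {A = Bool} U
  U-closed x x∉ = ⊥-elim (x∉ _)

  ∅-closed : IsClosed {A = Bool} ∅
  ∅-closed x _ = 0 , λ _ ()

  I-closed : ∀ {A : Set} (σ : List A) → IsClosed (I σ)
  I-closed σ x x∉ = length σ , λ {y} y∈ y∈I →
    x∉ (trans (sym (I-applyUpTo {x = x} {y} (length σ) y∈)) y∈I)

  closed-respects-≐ : ∀ {A : Set} {Q R : Pred (ℕ → A) 0ℓ} → Q ≐ R → IsClosed R → IsClosed Q
  closed-respects-≐ (Q⊆R , R⊆Q) cR x x∉Q = let (n , I⊆) = cR x (x∉Q ∘ R⊆Q) in
    n , λ y∈I y∈Q → I⊆ y∈I (Q⊆R y∈Q)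

  ↑U-borel : IsBorel {A = Fin 3} (↑ U)
  ↑U-borel = open-set λ _ _ → 0 , λ _ → lift _

  Hits-∅ : Hits ∅ ≐ ↑ ∅
  Hits-∅ = (λ { (_ , (_ , _ , ()) , _) }) , λ { (lift ()) }

  Hits-U : Hits U ≐ ↑ U
  Hits-U = (λ _ → lift _) , λ {x} _ → let K = Decode.decoded x em₀ ; (z , z∈K) = nonempty K in
    K , (z , z∈K , _) , Decode.decoded-code x em₀

  Hits-mono : ∀ {Q R} → Q ⊆ R → Hits Q ⊆ Hits R
  Hits-mono Q⊆R (K , (z , z∈K , z∈Q) , code) = K , (z , z∈K , Q⊆R z∈Q) , code

  -- The closed set that witnesses membership may vary with `n`. Injectivity of the coding moves all
  -- the points found into the set chosen for `n = 0`, where compactness yields one point common to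
  -- all `R n`.
  Hits-⋂ : ∀ {Q} (R : ℕ → Pred 2^ℕ 0ℓ) → (∀ n → IsClosed (R n)) → (∀ n → R (suc n) ⊆ R n) →
    Q ≐ ⋂ ℕ R → ⋂ ℕ (Hits ∘ R) ≐ Hits Q
  Hits-⋂ R cR dec (Q⊆ , ⊆Q) = to , λ x∈ n → Hits-mono (λ z∈Q → Q⊆ z∈Q n) x∈
    where
    to : ⋂ ℕ (Hits ∘ R) ⊆ Hits _
    to x∈ with x∈ 0
    ... | K , _ , code with compact-≬ K R cR dec (λ n →
        let (K′ , (z , z∈K′ , z∈R) , code′) = x∈ n
        in z , code-injective em₀ {K} {K′} code code′ z∈K′ , z∈R)
    ...   | z , z∈K , z∈R = K , (z , z∈K , ⊆Q z∈R) , code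

  join-Hits : ∀ {n} D (J : Subset n) (Q : Fin n → Pred 2^ℕ 0ℓ) →
    D ∪ Hits (⋃⟨ J ⟩ Q) ≐ join D J (Hits ∘ Q)
  join-Hits D J Q = to D J Q , from D J Q
    where
    to : ∀ {n} D (J : Subset n) Q → D ∪ Hits (⋃⟨ J ⟩ Q) ⊆ join D J (Hits ∘ Q)
    to D []            Q (inj₁ x∈D) = x∈D
    to D []            Q (inj₂ (_ , (_ , _ , () , _) , _))
    to D (outside ∷ J) Q (inj₁ x∈D) = to D J (Q ∘ suc) (inj₁ x∈D)
    to D (inside ∷ J)  Q (inj₁ x∈D) = to (D ∪ Hits (Q zero)) J (Q ∘ suc) (inj₁ (inj₁ x∈D))
    to D (outside ∷ J) Q (inj₂ (K , (z , z∈K , suc i , there i∈ , z∈Q) , code)) =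
      to D J (Q ∘ suc) (inj₂ (K , (z , z∈K , i , i∈ , z∈Q) , code))
    to D (inside ∷ J)  Q (inj₂ (K , (z , z∈K , zero , here , z∈Q) , code)) =
      to (D ∪ Hits (Q zero)) J (Q ∘ suc) (inj₁ (inj₂ (K , (z , z∈K , z∈Q) , code)))
    to D (inside ∷ J)  Q (inj₂ (K , (z , z∈K , suc i , there i∈ , z∈Q) , code)) =
      to (D ∪ Hits (Q zero)) J (Q ∘ suc) (inj₂ (K , (z , z∈K , i , i∈ , z∈Q) , code))

    shift : ∀ {n b} {J : Subset n} {Q : Fin (suc n) → Pred 2^ℕ 0ℓ} →
      Hits (⋃⟨ J ⟩ (Q ∘ suc)) ⊆ Hits (⋃⟨ b ∷ J ⟩ Q)
    shift = Hits-mono λ (i , i∈ , z∈Q) → suc i , there i∈ , z∈Q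

    from : ∀ {n} D (J : Subset n) Q → join D J (Hits ∘ Q) ⊆ D ∪ Hits (⋃⟨ J ⟩ Q)
    from D []            Q x∈ = inj₁ x∈
    from D (outside ∷ J) Q x∈ with from D J (Q ∘ suc) x∈
    ... | inj₁ x∈D = inj₁ x∈D
    ... | inj₂ x∈H = inj₂ (shift {Q = Q} x∈H)
    from D (inside ∷ J)  Q x∈ with from (D ∪ Hits (Q zero)) J (Q ∘ suc) x∈
    ... | inj₁ (inj₁ x∈D) = inj₁ x∈D
    ... | inj₁ (inj₂ x∈H) = inj₂ (Hits-mono (λ z∈Q → zero , here , z∈Q) x∈H)
    ... | inj₂ x∈H        = inj₂ (shift {Q = Q} x∈H)

  alternating-sum : ∀ {n} (Q : Fin n → Pred 2^ℕ 0ℓ) → (∀ i → IsClosed (Q i)) →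
    sum (List.map (λ J → -1^ suc Subset.∣ J ∣ · 𝒯 μ (⋃⟨ J ⟩ Q)) (nonemptySubsets n))
      ≈ alternatingSum (↑ ∅) (Hits ∘ Q)
  alternating-sum {n} Q cQ = begin
    sum (List.map (λ J → -1^ suc Subset.∣ J ∣ · 𝒯 μ (⋃⟨ J ⟩ Q)) (nonemptySubsets n))
      ≈⟨ ≈.reflexive (trans
           (cong sum (map-cong (λ J → -1^≡signed (suc Subset.∣ J ∣) (𝒯 μ (⋃⟨ J ⟩ Q))) (nonemptySubsets n)))
           (sum≡⨁ (List.map term (nonemptySubsets n)))) ⟩
    ⨁ (List.map term (nonemptySubsets n))
      ≈⟨ ⨁-filter nonempty? term (λ J ¬nonempty → signed-zero (suc Subset.∣ J ∣) (≈.trans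
           (μ-cong (borel J) ↑∅-borel
             ( (λ { (_ , (_ , _ , i , i∈ , _) , _) → ⊥-elim (¬nonempty (i , i∈)) }) , λ { (lift ()) }))
           μ-∅)) (subsets n) ⟩
    ⨁ (List.map term (subsets n))
      ≈⟨ ⨁-cong (λ J → signed-cong (suc Subset.∣ J ∣)
           (μ-cong (borel J) (join-borel ↑∅-borel J (Hits-borel ∘ cQ)) (joined J))) (subsets n) ⟩
    alternatingSum (↑ ∅) (Hits ∘ Q)
      ∎
    where
    open ≈-Reasoning

    term : Subset n → ℝ
    term J = signed (suc Subset.∣ J ∣) (𝒯 μ (⋃⟨ J ⟩ Q))

    joined : ∀ J → Hits (⋃⟨ J ⟩ Q) ≐ join (↑ ∅) J (Hits ∘ Q)
    joined J = (λ x∈ → proj₁ (join-Hits (↑ ∅) J Q) (inj₂ x∈)) ,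
      λ x∈ → [ (λ { (lift ()) }) , (λ x∈H → x∈H) ] (proj₂ (join-Hits (↑ ∅) J Q) x∈)

    -- Obtained from the finite union of events on the other side of `joined`, which avoids showing
    -- that finite unions of closed sets are closed.
    borel : ∀ J → IsBorel (Hits (⋃⟨ J ⟩ Q))
    borel J = respects-≐ (proj₂ (joined J) , proj₁ (joined J)) (join-borel ↑∅-borel J (Hits-borel ∘ cQ))

  𝒯-alternating : ∀ n → 2 ℕ.≤ n → (Q : Fin n → Pred 2^ℕ 0ℓ) → (∀ i → IsClosed (Q i)) →
    𝒯 μ (⋂ (Fin n) Q) ≲ sum (List.map (λ J → -1^ suc Subset.∣ J ∣ · 𝒯 μ (⋃⟨ J ⟩ Q)) (nonemptySubsets n))
  𝒯-alternating (suc n) _ Q cQ = begin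
    𝒯 μ (⋂ (Fin (suc n)) Q)
      -- The only inequality of the chain: a closed set may meet every `Q i` without meeting their
      -- intersection. Removing `↑ ∅` matches inclusion-exclusion with `D` empty.
      ≲⟨ μ-mono (∖-borel (⋂-borel (Hits-borel ∘ cQ)) ↑∅-borel) (Hits-borel (⋂-closed cQ))
           (λ x∈ → (λ i → Hits-mono (λ z∈ → z∈ i) x∈) , λ ()) ⟩
    μ (⋂ (Fin (suc n)) (Hits ∘ Q) ∖ ↑ ∅)
      ≈⟨ alternatingSum-⋂ ↑∅-borel (Hits-borel ∘ cQ) ⟨
    alternatingSum (↑ ∅) (Hits ∘ Q)
      ≈⟨ alternating-sum Q cQ ⟨
    sum (List.map (λ J → -1^ suc Subset.∣ J ∣ · 𝒯 μ (⋃⟨ J ⟩ Q)) (nonemptySubsets (suc n)))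
      ∎
    where open ≲-Reasoning

  𝒯-continuous : (Q : Pred 2^ℕ 0ℓ) (R : ℕ → Pred 2^ℕ 0ℓ) → (∀ n → IsClosed (R n)) →
    (∀ n → R (suc n) ⊆ R n) → Q ≐ ⋂ ℕ R → ConvergesTo (𝒯 μ ∘ R) (𝒯 μ Q)
  𝒯-continuous Q R cR dec Q≐ = limit-cong {𝒯 μ ∘ R}
    (μ-cong (⋂ℕ-borel bR) (Hits-borel (closed-respects-≐ Q≐ (⋂-closed cR))) (Hits-⋂ R cR dec Q≐))
    (μ-⋂-continuous bR (λ n → Hits-mono (dec n)))
    where
    bR : ∀ n → IsBorel (Hits (R n))
    bR n = Hits-borel (cR n)

  𝒯-isCapacity : IsCapacity (𝒯 μ)
  𝒯-isCapacity = record
    { lower       = λ Q cQ → nonneg (Hits-borel cQ)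
    ; upper       = λ Q cQ → ≲⇒≤ {𝒯 μ Q} {1ℝ}
        (≲-trans (μ-mono ↑U-borel (Hits-borel cQ) (λ _ → lift _)) (≈⇒≲ μ-U))
    ; empty       = ≈⇒≃ (≈.trans (μ-cong (Hits-borel ∅-closed) ↑∅-borel Hits-∅) μ-∅)
    ; full        = ≈⇒≃ {𝒯 μ U} {1ℝ} (≈.trans (μ-cong (Hits-borel U-closed) ↑U-borel Hits-U) μ-U)
    ; monotone    = λ Q R cQ cR Q⊆R → ≲⇒≤ (μ-mono (Hits-borel cR) (Hits-borel cQ) (Hits-mono Q⊆R))
    ; alternating = λ n 2≤n Q cQ → ≲⇒≤ (𝒯-alternating n 2≤n Q cQ)
    ; continuous  = 𝒯-continuous
    }

  Hits-clopen-borel : ∀ σs → IsBorel (Hits (λ x → Any (λ σ → x ∈ I σ) σs))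
  Hits-clopen-borel []       = respects-≐
    ((λ { (lift ()) }) , λ { (_ , (_ , _ , ()) , _) }) ↑∅-borel
  Hits-clopen-borel (σ ∷ σs) = respects-≐
    ( [ Hits-mono here , Hits-mono there ]
    , λ { (K , (z , z∈K , here z∈I) , code) → inj₁ (K , (z , z∈K , z∈I) , code)
        ; (K , (z , z∈K , there z∈) , code) → inj₂ (K , (z , z∈K , z∈) , code) })
    (∪-borel (Hits-borel (I-closed σ)) (Hits-clopen-borel σs))

  -- The capacity of the clopen set equals the measure of the translated family, so `f` is reused at
  -- the same precision `k`.
  𝒯-computable : IsComputableMeasure (μ *) → IsComputableCapacity (𝒯 μ)
  𝒯-computable (f , f-computable , approximates) = record
    { isCapacity = 𝒯-isCapacity
    ; computable = (λ (σs , k) → f (hittingTrees σs , k)) ,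
        comp f-computable (pair (comp hittingTrees-computable fst) snd) ,
        λ σs _ k → within-congˡ {z = fromℚ (rational (f (hittingTrees σs , k)))} {2^- k} (≈.sym (𝒯≈ σs))
          (approximates (hittingTrees σs) (hittingTrees-isTree σs) k)
    }
    where
    𝒯≈ : ∀ σs → 𝒯 μ (λ x → Any (λ σ → x ∈ I σ) σs) ≈ (μ *) (λ K → Any (λ A → K ∈ U[ A ]) (hittingTrees σs))
    -- The family of trees has a Borel image because that image is the hitting event itself.
    𝒯≈ σs = μ-cong (Hits-clopen-borel σs) (respects-≐ same (Hits-clopen-borel σs)) same
      where
      same : Hits (λ x → Any (λ σ → x ∈ I σ) σs) ≐ codes (λ K → Any (λ A → K ∈ U[ A ]) (hittingTrees σs))
      same = (λ (K , K∈ , code) → K , proj₁ (hits⇔hittingTree em₀ σs) {K} K∈ , code)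
           , (λ (K , K∈ , code) → K , proj₂ (hits⇔hittingTree em₀ σs) {K} K∈ , code)

theorem2p2 : ExcludedMiddle 1ℓ →
    (d : List (Fin 3) → ℝ) → IsMassFunction d →
    (μ : Pred 3^ℕ 1ℓ → ℝ) → IsBorelProbability μ → (∀ σ → μ (↑ (I σ)) ≃ d σ) →
    IsCapacity (𝒯 μ) × (IsComputableMeasure (μ *) → IsComputableCapacity (𝒯 μ))
theorem2p2 em _ _ μ isProbability _ = 𝒯-isCapacity , 𝒯-computable
  where open Capacity em isProbability
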